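{- Let $\ell\ge2$ and $k\ge0$. The map $\Upsilon_\ell^k$, which deletes the first column of the diagram of a partition, is a bijection $$\Upsilon_\ell^k:\{\text{partitions }\nu:\ \nu_1\le\ell-1,\ len(\nu)=k\}\to\{\text{partitions }\sigma:\ \sigma_1\le\ell-2,\ len(\sigma)\le k\},$$ and it satisfies $$\Upsilon_\ell^k\circ\rho_\ell=\rho_{\ell-1}\circ\widetilde{\Phi_\ell^k}$$ on the set of $\ell$-cores $\lambda$ with $len(\lambda)=k$, where $\widetilde{\Phi_\ell^k}=tr\circ\Phi_\ell^k\circ tr$.
   Context: $len(\lambda)$ is the number of nonzero parts of $\lambda$, $tr$ is transposition of partitions. The hook length of a box is the number of boxes to its right and below it (same row or column), including itself. An $\ell$-core is a partition with no hook length divisible by $\ell$. Bijection $\Phi_\ell^k$. An ($\ell$-)abacus has runners (columns) $0,\dots,\ell-1$ and levels (rows) $r\in\mathbb Z$; the entry on runner $j$, level $r$ is the integer $r\ell+j$. Some entries are beads, the others gaps, such that all sufficiently small integers are beads and all sufficiently large ones are gaps. An abacus determines a partition: its parts are, for each bead, the number of gaps preceding it in the linear order of the integers (discarding zeros). $\Phi_\ell^k$ maps $\ell$-cores with first part $k$ to $(\ell-1)$-cores with first part $\le k$: given any abacus of $\lambda$, delete the whole runner containing the largest bead and place the remaining runners in order (levels unchanged) into an $(\ell-1)$-abacus; $\Phi_\ell^k(\lambda)$ is the corresponding $(\ell-1)$-core (independent of the choice of abacus). Equivalently, $\Phi_\ell^k$ removes all rows of $\lambda$ whose first-column hook length is congruent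 mod $\ell$ to that of the first row. Thus $\widetilde{\Phi_\ell^k}=tr\circ\Phi_\ell^k\circ tr$ maps $\ell$-cores of length $k$ to $(\ell-1)$-cores of length $\le k$. Lapointe–Morse bijection $\rho_\ell:\{\ell\text{ -cores}\}\to\{\text{partitions with first part}\le\ell-1\}$: $\rho_\ell(\lambda)$ is obtained by left-justifying the rows of the skew diagram $\lambda/\gamma$, where $\gamma$ consists of the boxes of $\lambda$ with hook length $>\ell$; i.e. the $i$-th part of $\rho_\ell(\lambda)$ is the number of boxes in row $i$ of $\lambda$ with hook length $<\ell$. $\rho_{\ell-1}$ is the same with $\ell-1$ in place of $\ell$. -}

module Defs where

open import Data.Bool using (Bool; true; false; if_then_else_; _∨_)
open import Data.Fin using (Fin; toℕ; fromℕ; punchIn)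
open import Data.Fin.Properties using (toℕ<n)
open import Data.Integer as ℤ using (ℤ; +_; -_)
import Data.Integer.Properties as ℤ
open import Data.List using (List; []; _∷_; length; map; filter; foldl; upTo; allFin; cartesianProduct; applyUpTo)
open import Data.List.Properties using (filter-accept; filter-reject; length-filter; length-map)
open import Data.List.Membership.DecPropositional ℤ._≟_ using (_∈_; _∈?_)
open import Data.List.Membership.Propositional.Properties using (∈-applyUpTo⁻)
open import Data.List.Relation.Unary.All as All using (All; []; _∷_)
import Data.List.Relation.Unary.All.Properties as All
open import Data.List.Relation.Unary.Linked as Linked using (Linked; []; [-]; _∷_)
import Data.List.Relation.Unary.Linked.Properties as Linked
open import Data.Nat
open import Data.Nat.Divisibility using (_∣_)
open import Data.Nat.Properties
open import Data.Product using (Σ-syntax; _×_; _,_; uncurry)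
open import Relation.Binary.PropositionalEquality using (_≡_; refl; cong; sym; trans; subst)
open import Relation.Nullary using (¬_; does; yes; no; contradiction)
open import Relation.Nullary.Decidable using (dec-true; dec-false)

record Partition : Set where
  constructor mkPartition
  field
    parts      : List ℕ
    decreasing : Linked _≥_ parts
    positive   : All (1 ≤_) parts

open Partition public

len : Partition → ℕ
len μ = length (parts μ)

nth : List ℕ → ℕ → ℕ
nth []       _       = 0
nth (x ∷ _)  zero    = x
nth (_ ∷ xs) (suc i) = nth xs i

-- Rows and columns are numbered from 0; `part μ i` is 0 for i ≥ len μ.
part : Partition → ℕ → ℕ
part μ = nth (parts μ)

first : Partition → ℕ
first μ = part μ 0

column : Partition → ℕ → ℕ
column μ j = length (filter (j <?_) (parts μ))

nonzero : List ℕ → List ℕ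
nonzero = filter (1 ≤?_)

≥-trans : ∀ {i j k} → i ≥ j → j ≥ k → i ≥ k
≥-trans p q = ≤-trans q p

fromDecreasing : (xs : List ℕ) → Linked _≥_ xs → Partition
fromDecreasing xs d = mkPartition (nonzero xs)
  (Linked.filter⁺ (1 ≤?_) ≥-trans d) (All.all-filter (1 ≤?_) xs)

column-antitone : ∀ j xs → length (filter (suc j <?_) xs) ≤ length (filter (j <?_) xs)
column-antitone j [] = z≤n
column-antitone j (x ∷ xs) with suc j <? x | j <? x
... | yes p | yes q rewrite filter-accept (suc j <?_) {xs = xs} p | filter-accept (j <?_) {xs = xs} q
                    = s≤s (column-antitone j xs)
... | yes p | no ¬q = contradiction (<-trans (n<1+n j) p) ¬q
... | no ¬p | yes q rewrite filter-reject (suc j <?_) {xs = xs} ¬p | filter-accept (j <?_) {xs = xs} q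
                    = m≤n⇒m≤1+n (column-antitone j xs)
... | no ¬p | no ¬q rewrite filter-reject (suc j <?_) {xs = xs} ¬p | filter-reject (j <?_) {xs = xs} ¬q
                    = column-antitone j xs

column-positive : ∀ j xs → j < nth xs 0 → 1 ≤ length (filter (j <?_) xs)
column-positive j (x ∷ xs) j<x rewrite filter-accept (j <?_) {xs = xs} j<x = s≤s z≤n

tr : Partition → Partition
tr μ = mkPartition (applyUpTo (column μ) (first μ))
  (Linked.applyUpTo⁺₂ (column μ) (first μ) (λ j → column-antitone j (parts μ)))
  (All.applyUpTo⁺₁ (column μ) (first μ) (λ {j} → column-positive j (parts μ)))

-- Hook length of the box (i , j), meaningful when j < part μ i.
hook : Partition → ℕ → ℕ → ℕ
hook μ i j = suc ((part μ i ∸ suc j) + (column μ j ∸ suc i))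

IsCore : ℕ → Partition → Set
IsCore ℓ μ = ∀ i j → j < part μ i → ¬ (ℓ ∣ hook μ i j)

-- Beads are given in the coordinates (level, runner); the entry (r , j) is
-- the integer r * ℓ + j.  All levels below `bottom` consist of beads, and all
-- levels from `bottom + height` on consist of gaps.
record Abacus (ℓ : ℕ) : Set where
  field
    bead        : ℤ → Fin ℓ → Bool
    bottom      : ℤ
    height      : ℕ
    beads-below : ∀ r j → r ℤ.< bottom → bead r j ≡ true
    gaps-above  : ∀ r j → bottom ℤ.+ + height ℤ.≤ r → bead r j ≡ false

open Abacus public

-- The entries on the levels from `bottom` up to `bottom + height`
-- (exclusive), in increasing order of the integers r * ℓ + j.
window : ∀ {ℓ} → Abacus ℓ → List (ℤ × Fin ℓ)
window {ℓ} A = cartesianProduct (applyUpTo (λ h → bottom A ℤ.+ + h) (height A)) (allFin ℓ)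

-- gapCounts g acc w: the numbers of gaps preceding each bead of the word w
-- (true for a bead), from the last bead to the first, where g gaps come
-- before w and acc holds the counts of the beads before w.
gapCounts : ℕ → List ℕ → List Bool → List ℕ
gapCounts g acc []          = acc
gapCounts g acc (true  ∷ w) = gapCounts g (g ∷ acc) w
gapCounts g acc (false ∷ w) = gapCounts (suc g) acc w

gapCounts-decreasing : ∀ g acc w → Linked _≥_ (g ∷ acc) → Linked _≥_ (gapCounts g acc w)
gapCounts-decreasing g acc []          d = Linked.tail d
gapCounts-decreasing g acc (true  ∷ w) d = gapCounts-decreasing g (g ∷ acc) w (≤-refl ∷ d)
gapCounts-decreasing g []  (false ∷ w) d = gapCounts-decreasing (suc g) [] w [-]
gapCounts-decreasing g (x ∷ acc) (false ∷ w) (p ∷ d) =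
  gapCounts-decreasing (suc g) (x ∷ acc) w (m≤n⇒m≤1+n p ∷ d)

-- Beads below the window have no gap before them, so they give no part.
abacusPartition : ∀ {ℓ} → Abacus ℓ → Partition
abacusPartition A = fromDecreasing (gapCounts 0 [] word) (gapCounts-decreasing 0 [] word [-])
  where word = map (uncurry (bead A)) (window A)

-- If the window has no bead, the largest bead is the last entry of the level
-- just below it, which lies on the last runner.
largestBeadRunner : ∀ {n} → Abacus (suc n) → Fin (suc n)
largestBeadRunner {n} A =
  foldl (λ { p (r , j) → if bead A r j then j else p }) (fromℕ n) (window A)

deleteRunner : ∀ {n} → Fin (suc n) → Abacus (suc n) → Abacus n
deleteRunner p A = record
  { bead        = λ r j → bead A r (punchIn p j)
  ; bottom      = bottom A
  ; height      = height A
  ; beads-below = λ r j → beads-below A r (punchIn p j)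
  ; gaps-above  = λ r j → gaps-above A r (punchIn p j)
  }

-- The abacus of μ whose beads are the integers μᵢ - i, i ≥ 1, where μᵢ = 0
-- for i > len μ.
betaSet : Partition → List ℤ
betaSet μ = applyUpTo (λ i → + part μ i ℤ.- + suc i) (len μ)

isBead : Partition → ℤ → Bool
isBead μ x = does (x ℤ.<? - + len μ) ∨ does (x ∈? betaSet μ)

nth≤first : ∀ xs → Linked _≥_ xs → ∀ i → nth xs i ≤ nth xs 0
nth≤first []           _       i       = z≤n
nth≤first (x ∷ xs)     _       zero    = ≤-refl
nth≤first (x ∷ [])     _       (suc i) = z≤n
nth≤first (x ∷ y ∷ xs) (p ∷ d) (suc i) = ≤-trans (nth≤first (y ∷ xs) d i) p

entry : ∀ {ℓ} → ℤ → Fin ℓ → ℤ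
entry {ℓ} r j = r ℤ.* + ℓ ℤ.+ + toℕ j

entry<-len : ∀ {n} m r (j : Fin (suc n)) → r ℤ.< - + m → entry r j ℤ.< - + m
entry<-len {n} m r j r<-m = begin-strict
  r ℤ.* + suc n ℤ.+ + toℕ j   <⟨ ℤ.+-monoʳ-< (r ℤ.* + suc n) (ℤ.+<+ (toℕ<n j)) ⟩
  r ℤ.* + suc n ℤ.+ + suc n   ≡⟨ ℤ.+-comm (r ℤ.* + suc n) (+ suc n) ⟩
  + suc n ℤ.+ r ℤ.* + suc n   ≡⟨ sym (ℤ.suc-* r (+ suc n)) ⟩
  ℤ.suc r ℤ.* + suc n         ≤⟨ ℤ.*-monoʳ-≤-nonNeg (+ suc n) (ℤ.i<j⇒suc[i]≤j r<-m) ⟩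
  - + m ℤ.* + suc n           ≡⟨ sym (ℤ.neg-distribˡ-* (+ m) (+ suc n)) ⟩
  - (+ m ℤ.* + suc n)         ≡⟨ cong -_ (sym (ℤ.pos-* m (suc n))) ⟩
  - + (m * suc n)             ≤⟨ ℤ.neg-mono-≤ (ℤ.+≤+ (m≤m*n m (suc n))) ⟩
  - + m                       ∎
  where open ℤ.≤-Reasoning

first≤entry : ∀ {n} m r (j : Fin (suc n)) → + m ℤ.≤ r → + m ℤ.≤ entry r j
first≤entry {n} m r j m≤r = begin
  + m                         ≤⟨ ℤ.+≤+ (m≤m*n m (suc n)) ⟩
  + (m * suc n)               ≡⟨ ℤ.pos-* m (suc n) ⟩
  + m ℤ.* + suc n             ≤⟨ ℤ.*-monoʳ-≤-nonNeg (+ suc n) m≤r ⟩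
  r ℤ.* + suc n               ≤⟨ ℤ.i≤i+j _ (+ toℕ j) ⟩
  r ℤ.* + suc n ℤ.+ + toℕ j   ∎
  where open ℤ.≤-Reasoning

isBead-below : ∀ μ x → x ℤ.< - + len μ → isBead μ x ≡ true
isBead-below μ x x< rewrite dec-true (x ℤ.<? - + len μ) x< = refl

isBead-above : ∀ μ x → + first μ ℤ.≤ x → isBead μ x ≡ false
isBead-above μ x f≤x
  rewrite dec-false (x ℤ.<? - + len μ)
            (ℤ.≤⇒≯ (ℤ.≤-trans (ℤ.neg-≤-pos {len μ} {first μ}) f≤x))
  = dec-false (x ∈? betaSet μ) ¬x∈β
  where
  ¬x∈β : ¬ (x ∈ betaSet μ)
  ¬x∈β x∈β with ∈-applyUpTo⁻ (λ i → + part μ i ℤ.- + suc i) {n = len μ} x∈β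
  ... | i , _ , refl = ℤ.<⇒≱
    (ℤ.<-≤-trans (subst (ℤ._< + part μ i) (sym (ℤ.m-n≡m⊖n (part μ i) (suc i)))
                   (ℤ.m⊖1+n<m (part μ i) (suc i)))
                 (ℤ.+≤+ (nth≤first (parts μ) (decreasing μ) i)))
    f≤x

abacusOf : ∀ {n} → Partition → Abacus (suc n)
abacusOf μ = record
  { bead        = λ r j → isBead μ (entry r j)
  ; bottom      = - + len μ
  ; height      = len μ + first μ
  ; beads-below = λ r j r< → isBead-below μ (entry r j) (entry<-len (len μ) r j r<)
  ; gaps-above  = λ r j ≤r → isBead-above μ (entry r j)
                    (first≤entry (first μ) r j (subst (ℤ._≤ r) top ≤r))
  }
  where
  top : - + len μ ℤ.+ + (len μ + first μ) ≡ + first μ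
  top = trans (cong (λ x → - + len μ ℤ.+ x) (ℤ.pos-+ (len μ) (first μ)))
       (trans (sym (ℤ.+-assoc (- + len μ) (+ len μ) (+ first μ)))
       (trans (cong (λ x → x ℤ.+ + first μ) (ℤ.+-inverseˡ (+ len μ)))
              (ℤ.+-identityˡ (+ first μ))))

Φ : (ℓ : ℕ) .{{_ : NonTrivial ℓ}} → Partition → Partition
Φ (suc (suc n)) μ = abacusPartition (deleteRunner (largestBeadRunner A) A)
  where
  A : Abacus (suc (suc n))
  A = abacusOf μ

Φ̃ : (ℓ : ℕ) .{{_ : NonTrivial ℓ}} → Partition → Partition
Φ̃ ℓ μ = tr (Φ ℓ (tr μ))

-- The number of boxes in row i with hook length < ℓ.
shortHooks : ℕ → Partition → ℕ → ℕ
shortHooks ℓ μ i = length (filter (λ j → hook μ i j <? ℓ) (upTo (part μ i)))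

-- The nonzero parts of the Lapointe–Morse image.  They are weakly decreasing
-- when μ is an ℓ-core but not in general, so the value is a plain list.
ρ : ℕ → Partition → List ℕ
ρ ℓ μ = nonzero (applyUpTo (shortHooks ℓ μ) (len μ))

deleteFirstColumn : Partition → Partition
deleteFirstColumn ν = fromDecreasing (map pred (parts ν))
  (Linked.map⁺ (Linked.map pred-mono-≤ (decreasing ν)))

-- Partitions with first part ≤ m and exactly, respectively at most, k parts.
PartitionsOfLen : ℕ → ℕ → Set
PartitionsOfLen m k = Σ[ ν ∈ Partition ] (first ν ≤ m × len ν ≡ k)

PartitionsOfLen≤ : ℕ → ℕ → Set
PartitionsOfLen≤ m k = Σ[ σ ∈ Partition ] (first σ ≤ m × len σ ≤ k)

first-nonzero : ∀ xs → Linked _≥_ xs → nth (nonzero xs) 0 ≤ nth xs 0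
first-nonzero []               _       = z≤n
first-nonzero (suc x ∷ xs)     _       = ≤-refl
first-nonzero (zero ∷ [])      _       = z≤n
first-nonzero (zero ∷ y ∷ xs)  (p ∷ d) = ≤-trans (first-nonzero (y ∷ xs) d) p

nth-map-pred : ∀ xs → nth (map pred xs) 0 ≡ pred (nth xs 0)
nth-map-pred []      = refl
nth-map-pred (_ ∷ _) = refl

Υ : (ℓ k : ℕ) → PartitionsOfLen (ℓ ∸ 1) k → PartitionsOfLen≤ (ℓ ∸ 2) k
Υ ℓ k (ν , ν₁≤ , len≡) = deleteFirstColumn ν , σ₁≤ , len≤
  where
  σ₁≤ : first (deleteFirstColumn ν) ≤ ℓ ∸ 2
  σ₁≤ = begin
    first (deleteFirstColumn ν)   ≤⟨ first-nonzero (map pred (parts ν))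
                                       (Linked.map⁺ (Linked.map pred-mono-≤ (decreasing ν))) ⟩
    nth (map pred (parts ν)) 0    ≡⟨ nth-map-pred (parts ν) ⟩
    pred (first ν)                ≤⟨ pred-mono-≤ ν₁≤ ⟩
    pred (ℓ ∸ 1)                  ≡⟨ pred[m∸n]≡m∸[1+n] ℓ 1 ⟩
    ℓ ∸ 2                         ∎
    where open ≤-Reasoning
  len≤ : len (deleteFirstColumn ν) ≤ k
  len≤ = begin
    len (deleteFirstColumn ν)     ≤⟨ length-filter (1 ≤?_) (map pred (parts ν)) ⟩
    length (map pred (parts ν))   ≡⟨ length-map pred (parts ν) ⟩
    len ν                         ≡⟨ len≡ ⟩
    k                             ∎
    where open ≤-Reasoning

{-# OPTIONS --safe #-}
-- Index the columns of a core λ by m, and call m deleted when h(i , m) ≡ h(i , 0) mod ℓ,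
-- which does not depend on i. In the abacus of tr λ these columns are the beads on the runner of the
-- largest bead; since λ is a core, every gap of that runner comes after all beads, so Φ̃ just deletes these
-- columns. In each row the hooks of the deleted columns lie in one residue class mod ℓ, of which all
-- positive members below a hook of the row occur again in the row; hence exactly one box with hook
-- length < ℓ is deleted. Every other box has hook length < ℓ before the deletion if and only if it has
-- hook length < ℓ - 1 after it, so every row of the Lapointe–Morse image loses exactly one box.
module Submission where

open import Defs
import Algebra.Properties.AbelianGroup
open import Data.Bool using (Bool; true; false; if_then_else_)
open import Data.Empty using (⊥)
open import Data.Fin as Fin using (Fin; toℕ; punchIn; fromℕ)
import Data.Fin.Properties as Fin
open import Data.Integer as ℤ using (ℤ; +_; -_)
import Data.Integer.Properties as ℤ
import Data.Integer.Tactic.RingSolver as ℤSolver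
open import Data.List using (List; []; _∷_; _∷ʳ_; _++_; length; map; filter; foldl; upTo;
  applyUpTo; allFin; tabulate; cartesianProduct)
open import Data.List.Membership.DecPropositional ℤ._≟_ using (_∈_; _∈?_)
open import Data.List.Membership.Propositional.Properties using (∈-applyUpTo⁻; ∈-applyUpTo⁺)
open import Data.List.Properties
open import Data.List.Relation.Unary.All as All using (All; []; _∷_)
import Data.List.Relation.Unary.All.Properties as All
open import Data.List.Relation.Unary.Linked as Linked using (Linked; []; _∷_)
import Data.List.Relation.Unary.Linked.Properties as Linked
open import Data.Nat
open import Data.Nat.Divisibility using (_∣_; _∣?_; _∣0; divides; ∣-refl; ∣m+n∣m⇒∣n; ∣m∣n⇒∣m+n; >⇒∤)
open import Data.Nat.Properties
open import Data.Nat.Tactic.RingSolver using (solve-∀)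
open import Data.Product using (Σ-syntax; ∃-syntax; _×_; _,_; proj₁; proj₂; uncurry)
open import Data.Sum using (_⊎_; inj₁; inj₂)
open import Function.Base using (_∘_; id)
open import Function.Definitions using (Bijective; Injective; Surjective)
open import Relation.Binary.Definitions using (tri<; tri≈; tri>)
open import Relation.Binary.PropositionalEquality
open import Relation.Nullary using (¬_; Dec; yes; no; contradiction; ¬?)
open import Relation.Nullary.Decidable using (_×-dec_; decidable-stable; dec-true; dec-false)
open import Relation.Unary using (Decidable)

-- The delicate point is the last equivalence, because deletion does not lower all hooks by one. In
-- the transposed orientation used below, let s be the last deleted row meeting a given column.
-- Boxes below s lose nothing, but their hooks are smaller than that of s, which is itself short, so
-- they are already below ℓ - 1. A short box above s loses exactly one box of its leg: a second
-- deleted row in between would have a short hook congruent to that of s. A long box above s may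
-- lose several leg boxes, so no equality is available; that its hook stays at least ℓ - 1 is proved
-- by induction upwards from s, passing through deleted rows as well. The abacus half hands over
-- nothing but the column lengths of `Φ`. These suffice, since row lengths are recovered from the
-- equivalence of j < part i and i < column j, and no list of parts produced by an abacus has to be
-- computed.

private module ℤ+ = Algebra.Properties.AbelianGroup ℤ.+-0-abelianGroup

private variable
  P Q : ℕ → Set

-- Counting

count : Decidable P → ℕ → ℕ
count P? n = length (filter P? (upTo n))

count-snoc : (P? : Decidable P) → ∀ n → count P? (suc n) ≡ count P? n + length (filter P? (n ∷ []))
count-snoc P? n = begin
  length (filter P? (upTo (suc n)))                      ≡⟨ cong (length ∘ filter P?) (sym (upTo-∷ʳ n)) ⟩
  length (filter P? (upTo n ∷ʳ n))                       ≡⟨ cong length (filter-++ P? (upTo n) (n ∷ [])) ⟩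
  length (filter P? (upTo n) ++ filter P? (n ∷ []))      ≡⟨ length-++ (filter P? (upTo n)) ⟩
  count P? n + length (filter P? (n ∷ []))               ∎
  where open ≡-Reasoning

count-yes : (P? : Decidable P) → ∀ {n} → P n → count P? (suc n) ≡ suc (count P? n)
count-yes P? {n} p = trans (count-snoc P? n)
  (trans (cong (λ xs → count P? n + length xs) (filter-accept P? p)) (+-comm (count P? n) 1))

count-no : (P? : Decidable P) → ∀ {n} → ¬ P n → count P? (suc n) ≡ count P? n
count-no P? {n} ¬p = trans (count-snoc P? n)
  (trans (cong (λ xs → count P? n + length xs) (filter-reject P? ¬p)) (+-identityʳ (count P? n)))

count-suc-≤ : (P? : Decidable P) → ∀ n → count P? (suc n) ≤ suc (count P? n)
count-suc-≤ P? n with P? n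
... | yes p = ≤-reflexive (count-yes P? p)
... | no ¬p = ≤-trans (≤-reflexive (count-no P? ¬p)) (n≤1+n _)

count-≤-suc : (P? : Decidable P) → ∀ n → count P? n ≤ count P? (suc n)
count-≤-suc P? n with P? n
... | yes p = ≤-trans (n≤1+n _) (≤-reflexive (sym (count-yes P? p)))
... | no ¬p = ≤-reflexive (sym (count-no P? ¬p))

count-monoʳ : (P? : Decidable P) → ∀ {m n} → m ≤ n → count P? m ≤ count P? n
count-monoʳ P? m≤n = go (≤⇒≤′ m≤n)
  where
  go : ∀ {m n} → m ≤′ n → count P? m ≤ count P? n
  go ≤′-refl       = ≤-refl
  go (≤′-step m≤n) = ≤-trans (go m≤n) (count-≤-suc P? _)

count-strict : (P? : Decidable P) → ∀ {m n} → P m → m < n → count P? m < count P? n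
count-strict P? p m<n = ≤-trans (≤-reflexive (sym (count-yes P? p))) (count-monoʳ P? m<n)

count-mono : (P? : Decidable P) (Q? : Decidable Q) → ∀ n → (∀ {m} → m < n → P m → Q m) →
             count P? n ≤ count Q? n
count-mono P? Q? zero    P⊆Q = z≤n
count-mono P? Q? (suc n) P⊆Q with P? n | Q? n | count-mono P? Q? n (P⊆Q ∘ m<n⇒m<1+n)
... | yes p | yes q | ih rewrite count-yes P? p  | count-yes Q? q  = s≤s ih
... | yes p | no ¬q | ih = contradiction (P⊆Q (n<1+n n) p) ¬q
... | no ¬p | yes q | ih rewrite count-no P? ¬p  | count-yes Q? q  = m≤n⇒m≤1+n ih
... | no ¬p | no ¬q | ih rewrite count-no P? ¬p  | count-no Q? ¬q  = ih

count-cong : (P? : Decidable P) (Q? : Decidable Q) → ∀ n →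
             (∀ {m} → m < n → P m → Q m) → (∀ {m} → m < n → Q m → P m) → count P? n ≡ count Q? n
count-cong P? Q? n P⊆Q Q⊆P = ≤-antisym (count-mono P? Q? n P⊆Q) (count-mono Q? P? n Q⊆P)

count-except : (P? : Decidable P) (Q? : Decidable Q) → ∀ n a → a < n → ¬ P a → Q a →
               (∀ {m} → m < n → m ≢ a → P m → Q m) → (∀ {m} → m < n → m ≢ a → Q m → P m) →
               suc (count P? n) ≡ count Q? n
count-except P? Q? (suc n) a a<1+n ¬Pa Qa P⊆Q Q⊆P with a ≟ n
... | yes refl rewrite count-no P? ¬Pa | count-yes Q? Qa =
  cong suc (count-cong P? Q? n (λ m<n → P⊆Q (m<n⇒m<1+n m<n) (<⇒≢ m<n))
                               (λ m<n → Q⊆P (m<n⇒m<1+n m<n) (<⇒≢ m<n)))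
... | no a≢n with P? n | Q? n | count-except P? Q? n a (≤∧≢⇒< (s≤s⁻¹ a<1+n) a≢n) ¬Pa Qa
                                  (P⊆Q ∘ m<n⇒m<1+n) (Q⊆P ∘ m<n⇒m<1+n)
... | yes p | yes q | ih rewrite count-yes P? p  | count-yes Q? q  = cong suc ih
... | yes p | no ¬q | ih = contradiction (P⊆Q (n<1+n n) (a≢n ∘ sym) p) ¬q
... | no ¬p | yes q | ih = contradiction (Q⊆P (n<1+n n) (a≢n ∘ sym) q) ¬p
... | no ¬p | no ¬q | ih rewrite count-no P? ¬p  | count-no Q? ¬q  = ih

count-shift : (P? : Decidable P) → ∀ d n → count (P? ∘ (_+_ d)) n ≤ count P? (d + n)
count-shift P? d zero = z≤n
count-shift P? d (suc n) rewrite +-suc d n with P? (d + n)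
... | yes p rewrite count-yes P? p | count-yes (P? ∘ (_+_ d)) {n} p = s≤s (count-shift P? d n)
... | no ¬p rewrite count-no P? ¬p | count-no (P? ∘ (_+_ d)) {n} ¬p = count-shift P? d n

count-lower-bound : (P? : Decidable P) → ∀ n b → (∀ {m} → m < n → P m → b ≤ m) → count P? n ≤ n ∸ b
count-lower-bound P? zero    b b≤ = z≤n
count-lower-bound P? (suc n) b b≤ with P? n
... | yes p rewrite count-yes P? p | +-∸-assoc 1 (b≤ (n<1+n n) p) =
  s≤s (count-lower-bound P? n b (b≤ ∘ m<n⇒m<1+n))
... | no ¬p rewrite count-no P? ¬p =
  ≤-trans (count-lower-bound P? n b (b≤ ∘ m<n⇒m<1+n)) (∸-monoˡ-≤ b (n≤1+n n))

-- `count P?` enumerates the elements of P: it maps those below n onto the interval below `count P? n`.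
count-rank : (P? : Decidable P) (Q? : Decidable Q) → ∀ n →
             count Q? (count P? n) ≡ count (λ m → P? m ×-dec Q? (count P? m)) n
count-rank P? Q? zero = refl
count-rank P? Q? (suc n) with P? n
... | no ¬p = trans (cong (count Q?) (count-no P? ¬p))
  (trans (count-rank P? Q? n) (sym (count-no (λ m → P? m ×-dec Q? (count P? m)) (¬p ∘ proj₁))))
... | yes p with Q? (count P? n)
...   | yes q = trans (cong (count Q?) (count-yes P? p)) (trans (count-yes Q? q)
  (trans (cong suc (count-rank P? Q? n)) (sym (count-yes (λ m → P? m ×-dec Q? (count P? m)) (p , q)))))
...   | no ¬q = trans (cong (count Q?) (count-yes P? p)) (trans (count-no Q? ¬q)
  (trans (count-rank P? Q? n) (sym (count-no (λ m → P? m ×-dec Q? (count P? m)) (¬q ∘ proj₂)))))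

count-truncate : (P? : Decidable P) (Q? : Decidable Q) → ∀ {n N} → n ≤ N →
                 (∀ {m} → P m → m < n → Q m) → (∀ {m} → P m → Q m → m < n) →
                 count (λ m → P? m ×-dec Q? m) N ≡ count P? n
count-truncate P? Q? {n} n≤N lt⇒Q Q⇒lt = go (≤⇒≤′ n≤N)
  where
  PQ? = λ m → P? m ×-dec Q? m
  go : ∀ {N} → n ≤′ N → count PQ? N ≡ count P? n
  go ≤′-refl = count-cong PQ? P? n (λ _ → proj₁) (λ m<n p → p , lt⇒Q p m<n)
  go (≤′-step n≤N) =
    trans (count-no PQ? (λ (p , q) → <⇒≱ (Q⇒lt p q) (≤′⇒≤ n≤N))) (go n≤N)

count-full : (P? : Decidable P) → ∀ {a n} → a ≤ n → (∀ {m} → a ≤ m → m < n → P m) →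
             count P? n + a ≡ n + count P? a
count-full {P} P? {a} a≤n = go (≤⇒≤′ a≤n)
  where
  go : ∀ {n} → a ≤′ n → (∀ {m} → a ≤ m → m < n → P m) → count P? n + a ≡ n + count P? a
  go ≤′-refl       all = +-comm (count P? a) a
  go (≤′-step a≤n) all = trans (cong (_+ a) (count-yes P? (all (≤′⇒≤ a≤n) (n<1+n _))))
    (cong suc (go a≤n (λ a≤m m<n → all a≤m (m<n⇒m<1+n m<n))))

count-lipschitz : (P? : Decidable P) → ∀ {a n} → a ≤ n → count P? n + a ≤ n + count P? a
count-lipschitz P? {a} a≤n = go (≤⇒≤′ a≤n)
  where
  go : ∀ {n} → a ≤′ n → count P? n + a ≤ n + count P? a
  go ≤′-refl       = ≤-reflexive (+-comm (count P? a) a)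
  go (≤′-step a≤n) = ≤-trans (+-monoˡ-≤ a (count-suc-≤ P? _)) (s≤s (go a≤n))

last-true : (P? : Decidable P) → P 0 → ∀ n → ∃[ a ] a ≤ n × P a × (∀ {m} → a < m → m ≤ n → ¬ P m)
last-true P? p₀ zero = 0 , z≤n , p₀ , λ a<m m≤0 _ → <⇒≱ a<m m≤0
last-true P? p₀ (suc n) with P? (suc n)
... | yes p = suc n , ≤-refl , p , λ a<m m≤n _ → <⇒≱ a<m m≤n
... | no ¬p with last-true P? p₀ n
...   | a , a≤n , pa , last = a , m≤n⇒m≤1+n a≤n , pa , λ {m} a<m m≤1+n p → last a<m
  (s≤s⁻¹ (≤∧≢⇒< m≤1+n (λ { refl → ¬p p }))) p

-- Parts and columns

nth-[] : ∀ xs → ∀ {i} → length xs ≤ i → nth xs i ≡ 0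
nth-[] []       _       = refl
nth-[] (x ∷ xs) (s≤s p) = nth-[] xs p

nth-applyUpTo : ∀ (f : ℕ → ℕ) {n i} → i < n → nth (applyUpTo f n) i ≡ f i
nth-applyUpTo f {suc n} {zero}  _       = refl
nth-applyUpTo f {suc n} {suc i} (s≤s p) = nth-applyUpTo (f ∘ suc) p

filter-none-below : ∀ {xs} → Linked _≥_ xs → ∀ {j} → nth xs 0 ≤ j → filter (j <?_) xs ≡ []
filter-none-below {[]}     d p = refl
filter-none-below {x ∷ xs} d {j} p = trans (filter-reject (j <?_) (≤⇒≯ p))
  (filter-none-below (Linked.tail d) (≤-trans (nth≤first (x ∷ xs) d 1) p))

nth⇒filter : ∀ {xs} → Linked _≥_ xs → ∀ {i j} → j < nth xs i → i < length (filter (j <?_) xs)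
nth⇒filter {x ∷ xs} d {i} {j} j< rewrite filter-accept (j <?_) {xs = xs} (<-≤-trans j< (nth≤first (x ∷ xs) d i))
  with i
... | zero  = s≤s z≤n
... | suc i = s≤s (nth⇒filter (Linked.tail d) j<)

filter⇒nth : ∀ {xs} → Linked _≥_ xs → ∀ {i j} → i < length (filter (j <?_) xs) → j < nth xs i
filter⇒nth {x ∷ xs} d {i} {j} i< with j <? x
... | no j≮x rewrite filter-none-below d (≮⇒≥ j≮x) = contradiction i< λ ()
... | yes j<x rewrite filter-accept (j <?_) {xs = xs} j<x with i
...   | zero  = j<x
...   | suc i = filter⇒nth (Linked.tail d) (s≤s⁻¹ i<)

-- Both inequalities say that the box (i , j) lies in the diagram. Almost every fact relating rows
-- and columns goes through this lemma and its converse.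
part⇒column : ∀ μ {i j} → j < part μ i → i < column μ j
part⇒column μ = nth⇒filter (decreasing μ)

column⇒part : ∀ μ {i j} → i < column μ j → j < part μ i
column⇒part μ = filter⇒nth (decreasing μ)

-- Allows two row lengths to be compared box by box, which suits `part⇒column` and its converse.
below-unique : ∀ {m n} → (∀ {i} → i < m → i < n) → (∀ {i} → i < n → i < m) → m ≡ n
below-unique {m} {n} f g = ≤-antisym (≮⇒≥ (λ n<m → <-irrefl refl (f n<m))) (≮⇒≥ (λ m<n → <-irrefl refl (g m<n)))

part-antitone : ∀ μ {i j} → i ≤ j → part μ j ≤ part μ i
part-antitone μ i≤j = ≮⇒≥ λ p → <-irrefl refl (column⇒part μ (≤-<-trans i≤j (part⇒column μ p)))

column-mono : ∀ μ {i j} → i ≤ j → column μ j ≤ column μ i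
column-mono μ i≤j = ≮⇒≥ λ p → <-irrefl refl (part⇒column μ (≤-<-trans i≤j (column⇒part μ p)))

column-zero : ∀ μ → column μ 0 ≡ len μ
column-zero μ = cong length (filter-all (0 <?_) (positive μ))

part-tr : ∀ μ j → part (tr μ) j ≡ column μ j
part-tr μ j with j <? first μ
... | yes j< = nth-applyUpTo (column μ) j<
... | no j≮ = trans (nth-[] (parts (tr μ)) (≤-trans (≤-reflexive (length-applyUpTo (column μ) (first μ))) (≮⇒≥ j≮)))
  (sym (cong length (filter-none-below (decreasing μ) (≮⇒≥ j≮))))

column-tr : ∀ μ i → column (tr μ) i ≡ part μ i
column-tr μ i = below-unique
  (λ {j} p → column⇒part μ (subst (i <_) (part-tr μ j) (column⇒part (tr μ) p)))
  (λ {j} p → part⇒column (tr μ) (subst (i <_) (sym (part-tr μ j)) (part⇒column μ p)))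

hook-tr : ∀ μ i j → hook (tr μ) i j ≡ hook μ j i
hook-tr μ i j rewrite part-tr μ i | column-tr μ j = cong suc (+-comm (column μ i ∸ suc j) _)

IsCore-tr : ∀ {ℓ} μ → IsCore ℓ μ → IsCore ℓ (tr μ)
IsCore-tr {ℓ} μ core i j j< ∣h = core j i (column⇒part μ (subst (j <_) (part-tr μ i) j<))
  (subst (ℓ ∣_) (hook-tr μ i j) ∣h)

-- Hook lengths of a core

-- The hook length without truncated subtraction; later comparisons of hooks add suitable terms and
-- cancel.
hook-sum : ∀ μ {i j} → j < part μ i → hook μ i j + (suc i + j) ≡ part μ i + column μ j
hook-sum μ {i} {j} j< = begin
  suc (a + l) + (suc i + j)      ≡⟨ rearrange a l i j ⟩
  (a + suc j) + (l + suc i)      ≡⟨ cong₂ _+_ (m∸n+n≡m j<) (m∸n+n≡m (part⇒column μ j<)) ⟩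
  part μ i + column μ j          ∎
  where
  open ≡-Reasoning
  a = part μ i ∸ suc j
  l = column μ j ∸ suc i
  rearrange : ∀ a l i j → suc (a + l) + (suc i + j) ≡ (a + suc j) + (l + suc i)
  rearrange = solve-∀

hook-decreasing : ∀ μ {j a b} → a < b → b < column μ j → hook μ b j < hook μ a j
hook-decreasing μ {j} {a} {b} a<b b< = +-cancelʳ-< (suc b + j) _ _ (begin-strict
  hook μ b j + (suc b + j)  ≡⟨ hook-sum μ (column⇒part μ b<) ⟩
  part μ b + column μ j     ≤⟨ +-monoˡ-≤ (column μ j) (part-antitone μ (<⇒≤ a<b)) ⟩
  part μ a + column μ j     ≡⟨ sym (hook-sum μ (column⇒part μ (<-trans a<b b<))) ⟩
  hook μ a j + (suc a + j)  <⟨ +-monoʳ-< (hook μ a j) (s<s (+-monoˡ-< j a<b)) ⟩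
  hook μ a j + (suc b + j)  ∎)
  where open ≤-Reasoning

-- For cores, Φ deletes the rows m that are not kept: their first-column hook is congruent to that of row 0.
Kept : ℕ → Partition → ℕ → Set
Kept ℓ μ m = ¬ (ℓ ∣ (first μ ∸ part μ m) + m)

kept? : ∀ ℓ μ → Decidable (Kept ℓ μ)
kept? ℓ μ m = ¬? (ℓ ∣? (first μ ∸ part μ m) + m)

row0-deleted : ∀ ℓ μ → ℓ ∣ (first μ ∸ first μ) + 0
row0-deleted ℓ μ rewrite n∸n≡0 (first μ) = ℓ ∣0

-- Distance to the bead of row 0, hook length and column number have a sum that is the same for all
-- rows of a column (`total`). So whether two deleted or kept rows are congruent can be read off
-- their hooks in any column that meets both.
gap-hooks : ∀ μ {j a b} → a ≤ b → b < column μ j →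
            (first μ ∸ part μ b) + b ≡ (first μ ∸ part μ a) + a + (hook μ a j ∸ hook μ b j)
gap-hooks μ {j} {a} {b} a≤b b< = +-cancelʳ-≡ (hook μ b j) _ _ (+-cancelʳ-≡ (suc j) _ _ (begin
  D b + hook μ b j + suc j                            ≡⟨ total b b< ⟩
  first μ + column μ j                                ≡⟨ sym (total a (≤-<-trans a≤b b<)) ⟩
  D a + hook μ a j + suc j                            ≡⟨ cong (λ x → D a + x + suc j) (sym (m∸n+n≡m hb≤ha)) ⟩
  D a + (hook μ a j ∸ hook μ b j + hook μ b j) + suc j ≡⟨ cong (_+ suc j) (sym (+-assoc (D a) _ _)) ⟩
  D a + (hook μ a j ∸ hook μ b j) + hook μ b j + suc j ∎))
  where
  open ≡-Reasoning
  D : ℕ → ℕ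
  D m = (first μ ∸ part μ m) + m
  hb≤ha : hook μ b j ≤ hook μ a j
  hb≤ha with m≤n⇒m<n∨m≡n a≤b
  ... | inj₁ a<b  = <⇒≤ (hook-decreasing μ a<b b<)
  ... | inj₂ refl = ≤-refl
  total : ∀ m → m < column μ j → D m + hook μ m j + suc j ≡ first μ + column μ j
  total m m< = begin
    d + m + hook μ m j + suc j                ≡⟨ assoc d m (hook μ m j) j ⟩
    d + (hook μ m j + (suc m + j))            ≡⟨ cong (_+_ d) (hook-sum μ (column⇒part μ m<)) ⟩
    d + (part μ m + column μ j)               ≡⟨ sym (+-assoc d (part μ m) (column μ j)) ⟩
    d + part μ m + column μ j                 ≡⟨ cong (_+ column μ j) (m∸n+n≡m (part-antitone μ z≤n)) ⟩
    first μ + column μ j                      ∎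
    where
    d = first μ ∸ part μ m
    assoc : ∀ d m h j → d + m + h + suc j ≡ d + (h + (suc m + j))
    assoc = solve-∀

module _ {ℓ} .{{_ : NonZero ℓ}} (μ : Partition) (core : IsCore ℓ μ) where

  core-jump : ∀ {i j} → i < column μ j → ℓ ≤ hook μ i j → ℓ < hook μ i j
  core-jump {i} {j} i< ℓ≤ = ≤∧≢⇒< ℓ≤ λ ℓ≡ → core i j (column⇒part μ i<) (subst (ℓ ∣_) ℓ≡ ∣-refl)

  -- If h - ℓ were skipped between the rows m and 1 + m, the boundary of μ would
  -- have, at that place, a column b ending in row m, and the box (a , b) would have hook length ℓ.
  no-hook-skipped : ∀ {j a m v} → a < column μ j → a ≤ m → v + ℓ ≡ hook μ a j → v < hook μ m j → m < column μ j →
                    (suc m ≡ column μ j) ⊎ (suc m < column μ j × hook μ (suc m) j < v) → ⊥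
  no-hook-skipped {j} {a} {m} {v} a< a≤m v+ℓ≡ v<h m< next =
    core a b b<part-a (subst (ℓ ∣_) (sym hook≡ℓ) ∣-refl)
    where
    n = column μ j
    part≤ : part μ (suc m) + n ≤ v + (suc m + j)
    part≤ = bound next
      where
      bound : (suc m ≡ n) ⊎ (suc m < n × hook μ (suc m) j < v) → part μ (suc m) + n ≤ v + (suc m + j)
      bound (inj₁ 1+m≡n) = begin
        part μ (suc m) + n   ≤⟨ +-monoˡ-≤ n (≮⇒≥ λ j< → <-irrefl 1+m≡n (part⇒column μ j<)) ⟩
        j + n                ≡⟨ cong (_+_ j) (sym 1+m≡n) ⟩
        j + suc m            ≡⟨ +-comm j (suc m) ⟩
        suc m + j            ≤⟨ m≤n+m _ v ⟩
        v + (suc m + j)      ∎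
        where open ≤-Reasoning
      bound (inj₂ (1+m<n , h<v)) = begin
        part μ (suc m) + n                         ≡⟨ sym (hook-sum μ (column⇒part μ 1+m<n)) ⟩
        hook μ (suc m) j + suc (suc (m + j))       ≡⟨ +-suc (hook μ (suc m) j) (suc m + j) ⟩
        suc (hook μ (suc m) j + (suc m + j))       ≤⟨ +-monoˡ-≤ (suc m + j) h<v ⟩
        v + (suc m + j)                            ∎
        where open ≤-Reasoning
    b = v + (suc m + j) ∸ n
    b+n : b + n ≡ v + (suc m + j)
    b+n = m∸n+n≡m (≤-trans (m≤n+m n _) part≤)
    b<part-m : b < part μ m
    b<part-m = +-cancelʳ-< n _ _ (subst₂ _<_ (sym b+n) (hook-sum μ (column⇒part μ m<)) (+-monoˡ-< (suc m + j) v<h))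
    b<part-a = <-≤-trans b<part-m (part-antitone μ a≤m)
    column-b : column μ b ≡ suc m
    column-b = ≤-antisym
      (≮⇒≥ λ 1+m< → <⇒≱ (column⇒part μ 1+m<)
                      (+-cancelʳ-≤ n _ _ (subst (part μ (suc m) + n ≤_) (sym b+n) part≤)))
      (part⇒column μ b<part-m)
    hook≡ℓ : hook μ a b ≡ ℓ
    hook≡ℓ = +-cancelʳ-≡ (suc a + b) _ _ (+-cancelʳ-≡ n _ _ (begin
      hook μ a b + (suc a + b) + n       ≡⟨ cong (_+ n) (hook-sum μ b<part-a) ⟩
      part μ a + column μ b + n          ≡⟨ cong (λ x → part μ a + x + n) column-b ⟩
      part μ a + suc m + n               ≡⟨ swap (part μ a) (suc m) n ⟩
      part μ a + n + suc m               ≡⟨ cong (_+ suc m) (sym (hook-sum μ (column⇒part μ a<))) ⟩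
      hook μ a j + (suc a + j) + suc m   ≡⟨ cong (λ x → x + (suc a + j) + suc m) (sym v+ℓ≡) ⟩
      v + ℓ + (suc a + j) + suc m        ≡⟨ rearrange v ℓ a j m ⟩
      ℓ + suc a + (v + (suc m + j))      ≡⟨ cong (_+_ (ℓ + suc a)) (sym b+n) ⟩
      ℓ + suc a + (b + n)                ≡⟨ sym (+-assoc (ℓ + suc a) b n) ⟩
      ℓ + suc a + b + n                  ≡⟨ cong (_+ n) (+-assoc ℓ (suc a) b) ⟩
      ℓ + (suc a + b) + n                ∎))
      where
      open ≡-Reasoning
      swap : ∀ x y z → x + y + z ≡ x + z + y
      swap = solve-∀
      rearrange : ∀ v ℓ a j m → v + ℓ + (suc a + j) + suc m ≡ ℓ + suc a + (v + (suc m + j))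
      rearrange = solve-∀

  -- Hooks strictly decrease down the column, and `no-hook-skipped` forbids both jumping over v and
  -- reaching the end of the column while still above it.
  hook-minus-ℓ : ∀ {j a} → a < column μ j → ℓ < hook μ a j →
                 ∃[ m ] a < m × m < column μ j × hook μ m j + ℓ ≡ hook μ a j
  hook-minus-ℓ {j} {a} a< ℓ< = search (column μ j ∸ suc a) a ≤-refl (m∸n+n≡m a<) a<
                                 (∸-monoʳ-< {o = 0} (>-nonZero⁻¹ ℓ) (<⇒≤ ℓ<))
    where
    v = hook μ a j ∸ ℓ
    v+ℓ : v + ℓ ≡ hook μ a j
    v+ℓ = m∸n+n≡m (<⇒≤ ℓ<)
    -- `fuel` is the number of rows of column j below m; the invariant is that the hook in row m
    -- still exceeds v.
    search : ∀ fuel m → a ≤ m → fuel + suc m ≡ column μ j → m < column μ j → v < hook μ m j →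
             ∃[ m ] a < m × m < column μ j × hook μ m j + ℓ ≡ hook μ a j
    search zero m a≤m 1+m≡ m< v< = contradiction (inj₁ 1+m≡) (no-hook-skipped a< a≤m v+ℓ v< m<)
    search (suc fuel) m a≤m eq m< v<
      with 1+m< ← subst (suc m <_) eq (s≤s (m≤n+m (suc m) fuel)) | <-cmp (hook μ (suc m) j) v
    ... | tri< h<v _ _ = contradiction (inj₂ (1+m< , h<v)) (no-hook-skipped a< a≤m v+ℓ v< m<)
    ... | tri≈ _ h≡v _ = suc m , s≤s a≤m , 1+m< , trans (cong (_+ ℓ) h≡v) v+ℓ
    ... | tri> _ _ v<h = search fuel (suc m) (m≤n⇒m≤1+n a≤m) (trans (+-suc fuel (suc m)) eq) 1+m< v<h

-- Deleting rows of a core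

shortHooksInColumn : ℕ → Partition → ℕ → ℕ
shortHooksInColumn ℓ μ j = count (λ i → hook μ i j <? ℓ) (column μ j)

-- μ stands for the transpose of the core of the theorem, so it is rows that are deleted, and κ for Φ μ.
module _ {ℓ} (μ : Partition) (core : IsCore (suc ℓ) μ) (κ : Partition)
         (column-κ : ∀ j → column κ j ≡ count (kept? (suc ℓ) μ) (column μ j)) where

  private
    K? = kept? (suc ℓ) μ
    rank : ℕ → ℕ
    rank = count K?

  -- A kept row m lies strictly above row n exactly when its rank is strictly below `rank n`, so the
  -- column lengths of κ already determine its row of number `rank m`.
  part-κ : ∀ {m} → Kept (suc ℓ) μ m → part κ (rank m) ≡ part μ m
  part-κ {m} kept = below-unique
    (λ {j} j< → column⇒part μ (≰⇒> λ n≤m → <⇒≱ (subst (rank m <_) (column-κ j) (part⇒column κ j<))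
                                              (count-monoʳ K? n≤m)))
    (λ {j} j< → column⇒part κ (subst (rank m <_) (sym (column-κ j)) (count-strict K? kept (part⇒column μ j<))))

  module _ (j : ℕ) (j<first : j < first μ) where
    private
      n : ℕ
      n = column μ j
      -- The hook lengths in column j before and after the deletion.
      h h′ : ℕ → ℕ
      h m  = hook μ m j
      h′ m = suc ((part μ m ∸ suc j) + (rank n ∸ rank (suc m)))

      deleted-gap : ∀ {a b} → a ≤ b → b < n → ¬ Kept (suc ℓ) μ a → ¬ Kept (suc ℓ) μ b → suc ℓ ∣ h a ∸ h b
      deleted-gap {a} {b} a≤b b< ¬Ka ¬Kb = ∣m+n∣m⇒∣n
        (subst (suc ℓ ∣_) (gap-hooks μ a≤b b<) (decidable-stable (suc ℓ ∣? _) ¬Kb))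
        (decidable-stable (suc ℓ ∣? _) ¬Ka)

      last-deleted : ∃[ a ] a < n × ¬ Kept (suc ℓ) μ a × (∀ {m} → a < m → m < n → Kept (suc ℓ) μ m)
      last-deleted with last-true (λ m → suc ℓ ∣? (first μ ∸ part μ m) + m) (row0-deleted (suc ℓ) μ) (pred n)
      ... | a , a≤ , del , last = a , subst (suc a ≤_) (suc-pred n) (s≤s a≤) , (λ k → k del) ,
                                  λ a<m m<n → last a<m (≤-pred (subst (_ <_) (sym (suc-pred n)) m<n))
        where instance _ = >-nonZero (≤-<-trans z≤n (part⇒column μ j<first))

      s : ℕ
      s = proj₁ last-deleted
      s<n : s < n
      s<n = proj₁ (proj₂ last-deleted)
      s-deleted : ¬ Kept (suc ℓ) μ s
      s-deleted = proj₁ (proj₂ (proj₂ last-deleted))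
      kept-after : ∀ {m} → s < m → m < n → Kept (suc ℓ) μ m
      kept-after = proj₂ (proj₂ (proj₂ last-deleted))

      -- Otherwise `hook-minus-ℓ` yields a row below s whose hook is smaller by exactly the modulus
      -- `suc ℓ`. That row would be deleted too, although s is the last deleted one.
      short-s : h s < suc ℓ
      short-s = ≰⇒> λ ℓ≤h → let m , s<m , m<n , h+ℓ≡ = hook-minus-ℓ μ core s<n (core-jump μ core s<n ℓ≤h) in
        kept-after s<m m<n (subst (suc ℓ ∣_) (sym (gap-hooks μ (<⇒≤ s<m) m<n))
          (∣m∣n⇒∣m+n (decidable-stable (suc ℓ ∣? _) s-deleted)
            (subst (suc ℓ ∣_) (trans (sym (m+n∸m≡n (h m) (suc ℓ))) (cong (_∸ h m) h+ℓ≡)) ∣-refl)))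

      -- If m were deleted, `suc ℓ` would divide `h m ∸ h s`, which is positive and less than
      -- `suc ℓ`.
      short-kept : ∀ {m} → m < s → h m < suc ℓ → Kept (suc ℓ) μ m
      short-kept {m} m<s h< deleted = >⇒∤ {{>-nonZero (m<n⇒0<n∸m hs<hm)}} (≤-<-trans (m∸n≤m (h m) (h s)) h<)
        (deleted-gap (<⇒≤ m<s) s<n (λ k → k deleted) s-deleted)
        where hs<hm = hook-decreasing μ m<s s<n

      h-sum : ∀ {m} → m < n → h m + (suc m + j) ≡ part μ m + n
      h-sum m< = hook-sum μ (column⇒part μ m<)

      h′-sum : ∀ {m} → m < n → h′ m + (rank (suc m) + j) ≡ part μ m + rank n
      h′-sum {m} m< = begin
        suc (a + b) + (r + j)             ≡⟨ rearrange a b r j ⟩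
        (a + suc j) + (b + r)             ≡⟨ cong₂ _+_ (m∸n+n≡m (column⇒part μ m<)) (m∸n+n≡m (count-monoʳ K? m<)) ⟩
        part μ m + rank n                 ∎
        where
        open ≡-Reasoning
        a = part μ m ∸ suc j
        b = rank n ∸ rank (suc m)
        r = rank (suc m)
        rearrange : ∀ a b r j → suc (a + b) + (r + j) ≡ (a + suc j) + (b + r)
        rearrange = solve-∀

      h′≤h : ∀ {m} → m < n → h′ m ≤ h m
      h′≤h {m} m< = s≤s (+-monoʳ-≤ (part μ m ∸ suc j) (m≤n+o⇒m∸n≤o (rank n) (rank (suc m))
        (+-cancelʳ-≤ (suc m) _ _ (≤-trans (count-lipschitz K? m<) (≤-reflexive (begin
          n + r                       ≡⟨ cong (_+ r) (sym (m∸n+n≡m m<)) ⟩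
          n ∸ suc m + suc m + r       ≡⟨ rearrange (n ∸ suc m) (suc m) r ⟩
          r + (n ∸ suc m) + suc m     ∎))))))
        where
        open ≡-Reasoning
        r = rank (suc m)
        rearrange : ∀ x y z → x + y + z ≡ z + x + y
        rearrange = solve-∀

      rank-s : rank (suc s) ≡ rank s
      rank-s = count-no K? s-deleted

      -- Among the rows of the column below m only s is deleted, so the leg shrinks by one and the
      -- arm is unchanged.
      suc-h′-before-s : ∀ {m} → suc m ≡ s → suc (h′ m) ≡ h m
      suc-h′-before-s {m} 1+m≡s = +-cancelʳ-≡ (suc m + j + rank n + rank (suc m)) _ _ (begin
        suc (h′ m) + (suc m + j + rank n + rank (suc m))    ≡⟨ e₁ (h′ m) m j (rank n) (rank (suc m)) ⟩
        h′ m + (rank (suc m) + j) + (rank n + suc (suc m))       ≡⟨ cong₂ _+_ (h′-sum m<n) full ⟩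
        part μ m + rank n + (n + rank (suc m))                    ≡⟨ e₂ (part μ m) (rank n) n (rank (suc m)) ⟩
        part μ m + n + (rank n + rank (suc m))                    ≡⟨ cong (_+ (rank n + rank (suc m))) (sym (h-sum m<n)) ⟩
        h m + (suc m + j) + (rank n + rank (suc m))               ≡⟨ e₃ (h m) (suc m + j) (rank n) (rank (suc m)) ⟩
        h m + (suc m + j + rank n + rank (suc m))           ∎)
        where
        open ≡-Reasoning
        m<n : m < n
        m<n = <-trans (n<1+n m) (subst (_< n) (sym 1+m≡s) s<n)
        full : rank n + suc (suc m) ≡ n + rank (suc m)
        full = subst (λ x → rank n + suc x ≡ n + rank x) (sym 1+m≡s)
                 (trans (count-full K? s<n kept-after) (cong (_+_ n) rank-s))
        e₁ : ∀ x m j a b → suc x + (suc m + j + a + b) ≡ x + (b + j) + (a + suc (suc m))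
        e₁ = solve-∀
        e₂ : ∀ x a n b → x + a + (n + b) ≡ x + n + (a + b)
        e₂ = solve-∀
        e₃ : ∀ x a b c → x + a + (b + c) ≡ x + (a + b + c)
        e₃ = solve-∀

      h-step : ∀ {m} → suc m < n → h m + part μ (suc m) ≡ suc (h (suc m)) + part μ m
      h-step {m} 1+m< = +-cancelʳ-≡ (suc m + j + n) _ _ (begin
        h m + part μ (suc m) + (suc m + j + n)             ≡⟨ e₁ (h m) (part μ (suc m)) (suc m + j) n ⟩
        h m + (suc m + j) + (part μ (suc m) + n)           ≡⟨ cong₂ _+_ (h-sum (<-trans (n<1+n m) 1+m<)) (sym (h-sum 1+m<)) ⟩
        part μ m + n + (h (suc m) + (suc (suc m) + j))     ≡⟨ e₂ (part μ m) n (h (suc m)) m j ⟩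
        suc (h (suc m)) + part μ m + (suc m + j + n)       ∎)
        where
        open ≡-Reasoning
        e₁ : ∀ x p a n → x + p + (a + n) ≡ x + a + (p + n)
        e₁ = solve-∀
        e₂ : ∀ p n x m j → p + n + (x + (suc (suc m) + j)) ≡ suc x + p + (suc m + j + n)
        e₂ = solve-∀

      h′-step : ∀ {m} → suc m < n → Kept (suc ℓ) μ (suc m) →
                h′ m + part μ (suc m) ≡ suc (h′ (suc m)) + part μ m
      h′-step {m} 1+m< kept = +-cancelʳ-≡ (rank (suc m) + j + rank n) _ _ (begin
        h′ m + part μ (suc m) + (rank (suc m) + j + rank n)            ≡⟨ e₁ (h′ m) (part μ (suc m)) (rank (suc m) + j) (rank n) ⟩
        h′ m + (rank (suc m) + j) + (part μ (suc m) + rank n)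
          ≡⟨ cong₂ _+_ (h′-sum (<-trans (n<1+n m) 1+m<)) (sym (h′-sum 1+m<)) ⟩
        part μ m + rank n + (h′ (suc m) + (rank (suc (suc m)) + j))
          ≡⟨ cong (λ r → part μ m + rank n + (h′ (suc m) + (r + j))) (count-yes K? kept) ⟩
        part μ m + rank n + (h′ (suc m) + (suc (rank (suc m)) + j))    ≡⟨ e₂ (part μ m) (rank n) (h′ (suc m)) (rank (suc m)) j ⟩
        suc (h′ (suc m)) + part μ m + (rank (suc m) + j + rank n)      ∎)
        where
        open ≡-Reasoning
        e₁ : ∀ x p a n → x + p + (a + n) ≡ x + a + (p + n)
        e₁ = solve-∀
        e₂ : ∀ p n x r j → p + n + (x + (suc r + j)) ≡ suc x + p + (r + j + n)
        e₂ = solve-∀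

      -- Induction on the distance from s. The exact drop assumes that row 1 + m, not row m, is
      -- short: then all rows from there to s are short, hence all but s are kept. The second claim
      -- carries the bound upwards through long rows, kept or deleted; this is why `h′` is defined
      -- for deleted rows as well.
      before-s : ∀ d {m} → d + suc m ≡ s →
                 (h (suc m) < suc ℓ → suc (h′ m) ≡ h m) × (suc ℓ ≤ h m → suc ℓ ≤ suc (h′ m))
      before-s zero    {m} eq = (λ _ → suc-h′-before-s eq) , λ ℓ≤h → ≤-trans ℓ≤h (≤-reflexive (sym (suc-h′-before-s eq)))
      before-s (suc d) {m} eq = exact , long
        where
        1+m<s : suc m < s
        1+m<s = subst (suc m <_) eq (s≤s (m≤n+m (suc m) d))
        1+m<n = <-trans 1+m<s s<n
        ih = before-s d {suc m} (trans (+-suc d (suc m)) eq)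
        exact : h (suc m) < suc ℓ → suc (h′ m) ≡ h m
        exact h< = +-cancelʳ-≡ (part μ (suc m)) _ _ (begin
          suc (h′ m) + part μ (suc m)            ≡⟨ cong suc (h′-step 1+m<n (short-kept 1+m<s h<)) ⟩
          suc (suc (h′ (suc m))) + part μ m      ≡⟨ cong (λ x → suc x + part μ m)
                                                     (proj₁ ih (<-trans (hook-decreasing μ (n<1+n _) (≤-<-trans 1+m<s s<n)) h<)) ⟩
          suc (h (suc m)) + part μ m             ≡⟨ sym (h-step 1+m<n) ⟩
          h m + part μ (suc m)                   ∎)
          where open ≡-Reasoning
        long : suc ℓ ≤ h m → suc ℓ ≤ suc (h′ m)
        long ℓ≤h with h (suc m) <? suc ℓ
        ... | yes h< = ≤-trans ℓ≤h (≤-reflexive (sym (exact h<)))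
        -- Here only monotonicity is used: going up one row, neither the arm nor the number of kept
        -- rows below can decrease.
        ... | no h≮  = ≤-trans (proj₂ ih (≮⇒≥ h≮)) (s≤s (s≤s (+-mono-≤
          (∸-monoˡ-≤ (suc j) (part-antitone μ (n≤1+n m))) (∸-monoʳ-≤ (rank n) (count-≤-suc K? (suc m))))))

      hook-κ : ∀ {m} → Kept (suc ℓ) μ m → hook κ (rank m) j ≡ h′ m
      hook-κ {m} kept = cong suc (cong₂ _+_ (cong (_∸ suc j) (part-κ kept))
        (cong₂ _∸_ (column-κ j) (sym (count-yes K? kept))))

    shortHooksInColumn-deleted : suc (shortHooksInColumn ℓ κ j) ≡ shortHooksInColumn (suc ℓ) μ j
    shortHooksInColumn-deleted = begin
      suc (count S? (column κ j))     ≡⟨ cong (suc ∘ count S?) (column-κ j) ⟩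
      suc (count S? (rank n))         ≡⟨ cong suc (count-rank K? S? n) ⟩
      suc (count KS? n)               ≡⟨ count-except KS? T? n s s<n (s-deleted ∘ proj₁) short-s to from ⟩
      count T? n                      ∎
      where
      open ≡-Reasoning
      S? = λ m → hook κ m j <? ℓ
      KS? = λ m → K? m ×-dec S? (rank m)
      T? = λ m → h m <? suc ℓ
      distance : ∀ {m} → m < s → ∃[ d ] d + suc m ≡ s
      distance {m} m<s = s ∸ suc m , m∸n+n≡m m<s
      to : ∀ {m} → m < n → m ≢ s → Kept (suc ℓ) μ m × hook κ (rank m) j < ℓ → h m < suc ℓ
      to {m} m<n m≢s (kept , short) with <-cmp m s
      ... | tri< m<s _ _ = ≰⇒> λ ℓ≤h → <⇒≱ (s<s (subst (_< ℓ) (hook-κ kept) short))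
                                         (proj₂ (before-s (proj₁ (distance m<s)) (proj₂ (distance m<s))) ℓ≤h)
      ... | tri≈ _ m≡s _ = contradiction m≡s m≢s
      ... | tri> _ _ s<m = <-trans (hook-decreasing μ s<m m<n) short-s
      from : ∀ {m} → m < n → m ≢ s → h m < suc ℓ → Kept (suc ℓ) μ m × hook κ (rank m) j < ℓ
      from {m} m<n m≢s short with <-cmp m s
      ... | tri< m<s _ _ = kept , s<s⁻¹ (subst (_< suc ℓ) (trans (sym exact) (cong suc (sym (hook-κ kept)))) short)
        where
        kept = short-kept m<s short
        exact : suc (h′ m) ≡ h m
        exact = proj₁ (before-s (proj₁ (distance m<s)) (proj₂ (distance m<s)))
                  (<-trans (hook-decreasing μ (n<1+n m) (≤-<-trans m<s s<n)) short)
      ... | tri≈ _ m≡s _ = contradiction m≡s m≢s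
      ... | tri> _ _ s<m = kept , subst (_< ℓ) (sym (hook-κ kept))
                                    (≤-<-trans (h′≤h m<n) (<-≤-trans (hook-decreasing μ s<m m<n) (s≤s⁻¹ short-s)))
        where kept = kept-after s<m m<n

-- Abaci

shift-unique : ∀ {x a b c d} → x ℤ.+ + a ≡ + b → x ℤ.+ + c ≡ + d → b + c ≡ d + a
shift-unique {x} {a} {b} {c} {d} p q = ℤ.+-injective (begin
  + (b + c)             ≡⟨ ℤ.pos-+ b c ⟩
  + b ℤ.+ + c           ≡⟨ cong (ℤ._+ + c) (sym p) ⟩
  x ℤ.+ + a ℤ.+ + c     ≡⟨ swap x (+ a) (+ c) ⟩
  x ℤ.+ + c ℤ.+ + a     ≡⟨ cong (ℤ._+ + a) q ⟩
  + d ℤ.+ + a           ≡⟨ sym (ℤ.pos-+ d a) ⟩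
  + (d + a)             ∎)
  where
  open ≡-Reasoning
  swap : ∀ x y z → x ℤ.+ y ℤ.+ z ≡ x ℤ.+ z ℤ.+ y
  swap = ℤSolver.solve-∀

i-j+j≡i : ∀ x y → x ℤ.- y ℤ.+ y ≡ x
i-j+j≡i = ℤSolver.solve-∀

i+j-j≡i : ∀ x y → x ℤ.+ y ℤ.- y ≡ x
i+j-j≡i = ℤSolver.solve-∀

-- Row s may lie beyond `len μ`. It is then empty, and its bead -(1 + s) is one of those below
-- `- len μ`; so every bead of the abacus belongs to a row.
isBead-bead : ∀ μ s {x} → x ℤ.+ + suc s ≡ + part μ s → isBead μ x ≡ true
isBead-bead μ s {x} eq with s <? len μ | x ℤ.<? - + len μ
... | _       | yes x< = refl
... | yes s<  | no x≮ = dec-true (x ∈? betaSet μ)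
  (subst (_∈ betaSet μ) (trans (cong (ℤ._- + suc s) (sym eq)) (i+j-j≡i x (+ suc s)))
    (∈-applyUpTo⁺ (λ i → + part μ i ℤ.- + suc i) s<))
... | no s≮   | no x≮ = contradiction
  (subst (ℤ._< - + len μ) (sym x≡) (ℤ.neg-mono-< (ℤ.+<+ (s≤s (≮⇒≥ s≮)))))
  x≮
  where
  x≡ : x ≡ - + suc s
  x≡ = trans (sym (i+j-j≡i x (+ suc s)))
         (trans (cong (ℤ._- + suc s) (trans eq (cong +_ (nth-[] (parts μ) (≮⇒≥ s≮))))) (ℤ.+-identityˡ (- + suc s)))

-- The beads of rows m < s lie after x and those of rows m ≥ s before it.
isBead-gap : ∀ μ s {g x} → x ℤ.+ + s ≡ + g → part μ s ≤ g → (∀ {m} → m < s → g < part μ m) →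
             isBead μ x ≡ false
isBead-gap μ s {g} {x} eq p≤g g<p with x ℤ.<? - + len μ
... | yes x< = contradiction x< (ℤ.≤⇒≯ (s≤len⇒ (≮⇒≥ λ l< → n≮0 (subst (g <_) (nth-[] (parts μ) ≤-refl) (g<p l<)))))
  where
  s≤len⇒ : s ≤ len μ → - + len μ ℤ.≤ x
  s≤len⇒ s≤ = subst (- + len μ ℤ.≤_) (trans (cong (ℤ._- + s) (sym eq)) (i+j-j≡i x (+ s)))
    (ℤ.≤-trans (ℤ.neg-mono-≤ (ℤ.+≤+ s≤)) (ℤ.≤-trans (ℤ.≤-reflexive (sym (ℤ.+-identityˡ (- + s))))
      (ℤ.+-monoˡ-≤ (- + s) (ℤ.+≤+ z≤n))))
... | no _ = dec-false (x ∈? betaSet μ) not-beta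
  where
  not-beta : ¬ (x ∈ betaSet μ)
  not-beta x∈ with ∈-applyUpTo⁻ (λ i → + part μ i ℤ.- + suc i) {n = len μ} x∈
  ... | m , _ , x≡ with shift-unique {x} eq (trans (cong (ℤ._+ + suc m) x≡) (i-j+j≡i (+ part μ m) (+ suc m)))
  ...   | g+1+m≡ with m <? s
  ...     | yes m<s = <-irrefl g+1+m≡ (+-mono-<-≤ (g<p m<s) m<s)
  ...     | no m≮s  = <-irrefl (sym g+1+m≡)
    (+-mono-≤-< (≤-trans (part-antitone μ (≮⇒≥ m≮s)) p≤g) (s≤s (≮⇒≥ m≮s)))

-- Walks along the abacus of a partition

Position : ℕ → Set
Position ℓ = ℤ × Fin ℓ

data Consecutive {ℓ} : ℤ → List (Position ℓ) → Set where
  []  : ∀ {x} → Consecutive x []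
  _∷_ : ∀ {x r j ps} → entry r j ≡ x → Consecutive (ℤ.suc x) ps → Consecutive x ((r , j) ∷ ps)

-- The state (s , g) of a walk along the abacus of μ: s beads are still to come, and g gaps have
-- been passed, so that the current position is g - s.
data Walk (μ : Partition) {ℓ} : ℕ → ℕ → List (Position ℓ) → Set where
  end       : ∀ {g} → Walk μ 0 g []
  bead-step : ∀ {s r j ps} → entry r j ℤ.+ + suc s ≡ + part μ s →
              Walk μ s (part μ s) ps → Walk μ (suc s) (part μ s) ((r , j) ∷ ps)
  gap-step  : ∀ {s g r j ps} → entry r j ℤ.+ + s ≡ + g → part μ s ≤ g → (∀ {m} → m < s → g < part μ m) →
              Walk μ s (suc g) ps → Walk μ s g ((r , j) ∷ ps)

-- The next bead to come is that of row s - 1, and it is met as soon as g reaches its length; until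
-- then every step is a gap. The last hypothesis says that the list extends at least through
-- position first μ - 1, the largest bead, so no bead is missed.
walk : ∀ μ {ℓ x s g} {ps : List (Position ℓ)} → Consecutive x ps → x ℤ.+ + s ≡ + g →
       part μ s ≤ g → (∀ {m} → m < s → g ≤ part μ m) → first μ + s ≤ g + length ps → Walk μ s g ps
walk μ {s = zero}  []   eq p≤ ≤p long = end
walk μ {s = suc s} {g} [] eq p≤ ≤p long = contradiction (≤p z<s)
  (<⇒≱ (first<g long))
  where
  first<g : first μ + suc s ≤ g + 0 → first μ < g
  first<g l = ≤-trans (s≤s (m≤m+n _ s)) (≤-trans (≤-reflexive (sym (+-suc (first μ) s)))
    (≤-trans l (≤-reflexive (+-identityʳ g))))
walk μ {s = zero} {g} (_∷_ {x = x} {ps = ps} refl c) eq p≤ ≤p long =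
  gap-step eq p≤ (λ ()) (walk μ c (trans (ℤ.+-assoc (+ 1) x (+ 0)) (cong ℤ.suc eq)) (m≤n⇒m≤1+n p≤) (λ ())
    (subst (first μ + 0 ≤_) (+-suc g (length ps)) long))
walk μ {s = suc s} {g} (_∷_ {x = x} {ps = ps} refl c) eq p≤ ≤p long with m≤n⇒m<n∨m≡n (≤p (n<1+n s))
... | inj₁ g<p = gap-step eq p≤ (λ m< → <-≤-trans g<p (part-antitone μ (s≤s⁻¹ m<)))
  (walk μ c (trans (ℤ.+-assoc (+ 1) x (+ suc s)) (cong ℤ.suc eq)) (m≤n⇒m≤1+n p≤)
    (λ m< → <-≤-trans g<p (part-antitone μ (s≤s⁻¹ m<)))
    (subst (first μ + suc s ≤_) (+-suc g (length ps)) long))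
... | inj₂ refl = bead-step eq
  (walk μ c (trans (assoc x (+ 1) (+ s)) eq) ≤-refl (λ m< → part-antitone μ (<⇒≤ m<))
    (s≤s⁻¹ (subst₂ _≤_ (+-suc (first μ) s) (+-suc g (length ps)) long)))
  where
  assoc : ∀ x y z → y ℤ.+ x ℤ.+ z ≡ x ℤ.+ (y ℤ.+ z)
  assoc = ℤSolver.solve-∀

-- The runner of the largest bead

IsLastBeadRunner : Partition → ∀ {ℓ} → Fin ℓ → Set
IsLastBeadRunner μ p = ∃[ r ] entry r p ℤ.+ + 1 ≡ + first μ

-- The accumulator has to be correct only once no bead is left, and the bead of row 0 makes it so.
-- The folded function enters through its defining equation so that the fold in `largestBeadRunner`
-- is an instance.
foldl-lastBeadRunner : ∀ μ {ℓ} (f : Fin ℓ → Position ℓ → Fin ℓ) →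
                       (∀ p r j → f p (r , j) ≡ (if isBead μ (entry r j) then j else p)) →
                       ∀ {s g ps} → Walk μ s g ps → ∀ p → (s ≡ 0 → IsLastBeadRunner μ p) →
                       IsLastBeadRunner μ (foldl f p ps)
foldl-lastBeadRunner μ f f-def end p last = last refl
foldl-lastBeadRunner μ f f-def (bead-step {s} {r} {j} {ps} eq w) p last =
  subst (λ q → IsLastBeadRunner μ (foldl f q ps))
    (sym (trans (f-def p r j) (cong (if_then j else p) (isBead-bead μ s eq))))
    (foldl-lastBeadRunner μ f f-def w j λ { refl → r , eq })
foldl-lastBeadRunner μ f f-def (gap-step {s} {g} {r} {j} {ps} eq p≤ <p w) p last =
  subst (λ q → IsLastBeadRunner μ (foldl f q ps))
    (sym (trans (f-def p r j) (cong (if_then j else p) (isBead-gap μ s eq p≤ <p))))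
    (foldl-lastBeadRunner μ f f-def w p last)

entry-mono-< : ∀ {ℓ r r′} (i j : Fin ℓ) → r ℤ.< r′ → entry r i ℤ.< entry r′ j
entry-mono-< {ℓ} {r} {r′} i j r<r′ = begin-strict
  r ℤ.* + ℓ ℤ.+ + toℕ i    <⟨ ℤ.+-monoʳ-< (r ℤ.* + ℓ) (ℤ.+<+ (Fin.toℕ<n i)) ⟩
  r ℤ.* + ℓ ℤ.+ + ℓ        ≡⟨ ℤ.+-comm (r ℤ.* + ℓ) (+ ℓ) ⟩
  + ℓ ℤ.+ r ℤ.* + ℓ        ≡⟨ sym (ℤ.suc-* r (+ ℓ)) ⟩
  ℤ.suc r ℤ.* + ℓ          ≤⟨ ℤ.*-monoʳ-≤-nonNeg (+ ℓ) (ℤ.i<j⇒suc[i]≤j r<r′) ⟩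
  r′ ℤ.* + ℓ               ≤⟨ ℤ.i≤i+j _ (+ toℕ j) ⟩
  r′ ℤ.* + ℓ ℤ.+ + toℕ j   ∎
  where open ℤ.≤-Reasoning

entry-injectiveʳ : ∀ {ℓ r r′} {i j : Fin ℓ} → entry r i ≡ entry r′ j → i ≡ j
entry-injectiveʳ {ℓ} {r} {r′} {i} {j} eq with ℤ.<-cmp r r′
... | tri< r< _ _ = contradiction (entry-mono-< i j r<) (ℤ.<-irrefl eq)
... | tri> _ _ r> = contradiction (entry-mono-< j i r>) (ℤ.<-irrefl (sym eq))
... | tri≈ _ refl _ = Fin.toℕ-injective (ℤ.+-injective (ℤ+.∙-cancelˡ (r ℤ.* + ℓ) _ _ eq))

module _ {ℓ} {r r′ : ℤ} {i j : Fin ℓ} {d : ℕ} (eq : entry r′ j ≡ entry r i ℤ.+ + d) where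

  sameRunner⇒∣ : i ≡ j → ℓ ∣ d
  sameRunner⇒∣ refl = divides ℤ.∣ r′ ℤ.- r ∣ (trans (cong ℤ.∣_∣ d≡) (ℤ.abs-* (r′ ℤ.- r) (+ ℓ)))
    where
    open ≡-Reasoning
    e₁ : ∀ a t d → d ≡ a ℤ.+ t ℤ.+ d ℤ.- (a ℤ.+ t)
    e₁ = ℤSolver.solve-∀
    e₂ : ∀ r r′ l t → r′ ℤ.* l ℤ.+ t ℤ.- (r ℤ.* l ℤ.+ t) ≡ (r′ ℤ.- r) ℤ.* l
    e₂ = ℤSolver.solve-∀
    d≡ : + d ≡ (r′ ℤ.- r) ℤ.* + ℓ
    d≡ = begin
      + d                                       ≡⟨ e₁ (r ℤ.* + ℓ) (+ toℕ i) (+ d) ⟩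
      entry r i ℤ.+ + d ℤ.- entry r i           ≡⟨ cong (ℤ._- entry r i) (sym eq) ⟩
      entry r′ i ℤ.- entry r i                  ≡⟨ e₂ r r′ (+ ℓ) (+ toℕ i) ⟩
      (r′ ℤ.- r) ℤ.* + ℓ                        ∎

  ∣⇒sameRunner : ℓ ∣ d → i ≡ j
  ∣⇒sameRunner (divides q refl) = entry-injectiveʳ {r = r ℤ.+ + q} {r′ = r′} (sym (begin
    entry r′ j                                       ≡⟨ eq ⟩
    r ℤ.* + ℓ ℤ.+ + toℕ i ℤ.+ + (q * ℓ)              ≡⟨ cong (λ x → entry r i ℤ.+ x) (ℤ.pos-* q ℓ) ⟩
    r ℤ.* + ℓ ℤ.+ + toℕ i ℤ.+ + q ℤ.* + ℓ            ≡⟨ e (+ ℓ) r (+ toℕ i) (+ q) ⟩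
    (r ℤ.+ + q) ℤ.* + ℓ ℤ.+ + toℕ i                  ∎))
    where
    open ≡-Reasoning
    e : ∀ l r t q → r ℤ.* l ℤ.+ t ℤ.+ q ℤ.* l ≡ (r ℤ.+ q) ℤ.* l ℤ.+ t
    e = ℤSolver.solve-∀

-- For the bead of row s, where g is the length of that row, this distance is the number tested by
-- `Kept`; for a gap before the last bead it is a hook length of row 0.
distance-to-last : ∀ {x y s g f} → x ℤ.+ + suc s ≡ + g → y ℤ.+ + 1 ≡ + f → g ≤ f → y ≡ x ℤ.+ + (f ∸ g + s)
distance-to-last {x} {y} {s} {g} {f} x≡ y≡ g≤f = ℤ+.∙-cancelʳ (+ 1) _ _ (begin
  y ℤ.+ + 1                                 ≡⟨ y≡ ⟩
  + f                                       ≡⟨ cong +_ (sym (m∸n+n≡m g≤f)) ⟩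
  + (f ∸ g + g)                             ≡⟨ ℤ.pos-+ (f ∸ g) g ⟩
  + (f ∸ g) ℤ.+ + g                         ≡⟨ cong (λ z → + (f ∸ g) ℤ.+ z) (sym x≡) ⟩
  + (f ∸ g) ℤ.+ (x ℤ.+ (+ 1 ℤ.+ + s))       ≡⟨ e (+ (f ∸ g)) x (+ 1) (+ s) ⟩
  x ℤ.+ (+ (f ∸ g) ℤ.+ + s) ℤ.+ + 1         ≡⟨ cong (λ z → x ℤ.+ z ℤ.+ + 1) (sym (ℤ.pos-+ (f ∸ g) s)) ⟩
  x ℤ.+ + (f ∸ g + s) ℤ.+ + 1               ∎)
  where
  open ≡-Reasoning
  e : ∀ d x o s → d ℤ.+ (x ℤ.+ (o ℤ.+ s)) ≡ x ℤ.+ (d ℤ.+ s) ℤ.+ o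
  e = ℤSolver.solve-∀

-- Gap counts after the deletion of the last bead's runner

otherRunner? : ∀ {ℓ} (p : Fin ℓ) → (e : Position ℓ) → Dec (¬ (proj₂ e ≡ p))
otherRunner? p e = ¬? (proj₂ e Fin.≟ p)

module _ {ℓ} (μ : Partition) (core : IsCore ℓ μ) (p : Fin ℓ) (p-last : IsLastBeadRunner μ p) (i : ℕ) where

  word : List (Position ℓ) → List Bool
  word ps = map (λ e → isBead μ (uncurry entry e)) (filter (otherRunner? p) ps)

  lastRunner⇒∣ : ∀ {s g} r j → entry r j ℤ.+ + suc s ≡ + g → g ≤ first μ → j ≡ p → ℓ ∣ first μ ∸ g + s
  lastRunner⇒∣ {s} r j eq g≤ =
    sameRunner⇒∣ {r = r} {r′ = proj₁ p-last} (distance-to-last {entry r j} {s = s} eq (proj₂ p-last) g≤)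

  ∣⇒lastRunner : ∀ {s g} r j → entry r j ℤ.+ + suc s ≡ + g → g ≤ first μ → ℓ ∣ first μ ∸ g + s → j ≡ p
  ∣⇒lastRunner {s} r j eq g≤ =
    ∣⇒sameRunner {r = r} {r′ = proj₁ p-last} (distance-to-last {entry r j} {s = s} eq (proj₂ p-last) g≤)

  -- No gap of the deleted runner precedes the last bead: it would be a hook of row 0 divisible by ℓ.
  no-deleted-gap : ∀ {s g r} → entry r p ℤ.+ + suc s ≡ + g → part μ (suc s) ≤ g →
                   (∀ {m} → m < suc s → g < part μ m) → ⊥
  no-deleted-gap {s} {g} {r} eq p≤ <p = core 0 g (<p z<s)
    (subst (ℓ ∣_) (sym hook≡)
      (lastRunner⇒∣ r p eq (<⇒≤ (<p z<s)) refl))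
    where
    column≡ : column μ g ≡ suc s
    -- A gap passed in state (1 + s , g) marks the end of column g on the boundary of μ, with the
    -- rows 0 to s above it.
    column≡ = ≤-antisym (≮⇒≥ λ s< → <⇒≱ (column⇒part μ s<) p≤) (part⇒column μ (<p (n<1+n s)))
    hook≡ : hook μ 0 g ≡ first μ ∸ g + s
    hook≡ = cong₂ _+_ (sym (+-∸-assoc 1 (<p z<s))) (cong pred column≡)

  -- `g′` counts gaps of the remaining runners, `g` gaps of all runners. They agree while beads
  -- remain, as the deleted runner has no earlier gap, so each surviving bead contributes its old
  -- row length. Afterwards `g′` enters no part.
  count-parts : ∀ {s g ps} → Walk μ s g ps → ∀ g′ acc → (0 < s → g′ ≡ g) →
                length (filter (i <?_) (gapCounts g′ acc (word ps))) ≡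
                count (λ m → kept? ℓ μ m ×-dec i <? part μ m) s + length (filter (i <?_) acc)
  count-parts end g′ acc _ = refl
  count-parts (bead-step {s} {r} {j} {ps} eq w) g′ acc g′≡ with g′≡ z<s | j Fin.≟ p
  ... | refl | yes j≡p = trans
    (count-parts w (part μ s) acc (λ _ → refl)) (cong (_+ length (filter (i <?_) acc))
      (sym (count-no (λ m → kept? ℓ μ m ×-dec i <? part μ m) (λ (k , _) → k (lastRunner⇒∣ r j eq (part-antitone μ z≤n) j≡p)))))
  ... | refl | no j≢p = trans
    (cong (λ b → length (filter (i <?_) (gapCounts g′ acc (b ∷ word ps)))) (isBead-bead μ s {entry r j} eq))
    (trans (count-parts w (part μ s) (part μ s ∷ acc) (λ _ → refl)) push)
    where
    KI? = λ m → kept? ℓ μ m ×-dec i <? part μ m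
    kept : Kept ℓ μ s
    kept ∣d = j≢p (∣⇒lastRunner r j eq (part-antitone μ z≤n) ∣d)
    push : count KI? s + length (filter (i <?_) (part μ s ∷ acc)) ≡ count KI? (suc s) + length (filter (i <?_) acc)
    push with i <? part μ s
    ... | yes i< = trans (cong (λ v → count KI? s + length v) (filter-accept (i <?_) i<))
      (trans (+-suc _ _) (cong (_+ length (filter (i <?_) acc)) (sym (count-yes KI? (kept , i<)))))
    ... | no i≮  = trans (cong (λ v → count KI? s + length v) (filter-reject (i <?_) i≮))
      (cong (_+ length (filter (i <?_) acc)) (sym (count-no KI? (λ (_ , i<) → i≮ i<))))
  count-parts (gap-step {s} {g} {r} {j} {ps} eq p≤ <p w) g′ acc g′≡ with j Fin.≟ p
  ... | no j≢p = trans
    (cong (λ b → length (filter (i <?_) (gapCounts g′ acc (b ∷ word ps)))) (isBead-gap μ s {x = entry r j} eq p≤ <p))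
    (count-parts w (suc g′) acc (cong suc ∘ g′≡))
  -- Now `g` grows and `g′` does not, which is harmless only because no bead is left.
  ... | yes refl = count-parts w g′ acc (λ 0<s → contradiction 0<s (no-beads-left s eq p≤ <p))
    where
    no-beads-left : ∀ s → entry r p ℤ.+ + s ≡ + g → part μ s ≤ g → (∀ {m} → m < s → g < part μ m) → ¬ (0 < s)
    no-beads-left (suc s) eq p≤ <p _ = no-deleted-gap {r = r} eq p≤ <p

-- The window as a run of consecutive integers

Consecutive-++ : ∀ {ℓ x} {ps qs : List (ℤ × Fin ℓ)} → Consecutive x ps →
                 Consecutive (x ℤ.+ + length ps) qs → Consecutive x (ps ++ qs)
Consecutive-++ {x = x} [] c = subst (λ y → Consecutive y _) (ℤ.+-identityʳ x) c
Consecutive-++ {x = x} {qs = qs} (_∷_ {ps = ps} eq d) c =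
  eq ∷ Consecutive-++ d (subst (λ y → Consecutive y qs) (assoc x (+ 1) (+ length ps)) c)
  where
  assoc : ∀ x y z → x ℤ.+ (y ℤ.+ z) ≡ y ℤ.+ x ℤ.+ z
  assoc = ℤSolver.solve-∀

-- A level is the case of `id` and 0; the recursion of `tabulate` replaces `f` by `f ∘ Fin.suc`,
-- which raises the offset `a`.
Consecutive-tabulate : ∀ {ℓ} r {n} (f : Fin n → Fin ℓ) a → (∀ i → toℕ (f i) ≡ a + toℕ i) →
                       Consecutive (r ℤ.* + ℓ ℤ.+ + a) (map (r ,_) (tabulate f))
Consecutive-tabulate r {zero}  f a f≡ = []
Consecutive-tabulate {ℓ} r {suc n} f a f≡ =
  cong (λ t → r ℤ.* + ℓ ℤ.+ + t) (trans (f≡ Fin.zero) (+-identityʳ a)) ∷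
  subst (λ y → Consecutive y _) (swap (r ℤ.* + ℓ) (+ 1) (+ a))
    (Consecutive-tabulate r (f ∘ Fin.suc) (suc a) (λ i → trans (f≡ (Fin.suc i)) (+-suc a (toℕ i))))
  where
  swap : ∀ x y z → x ℤ.+ (y ℤ.+ z) ≡ y ℤ.+ (x ℤ.+ z)
  swap = ℤSolver.solve-∀

Consecutive-levels : ∀ {ℓ} (f : ℕ → ℤ) → (∀ h → f (suc h) ≡ ℤ.suc (f h)) → ∀ H →
                     Consecutive (f 0 ℤ.* + ℓ) (cartesianProduct (applyUpTo f H) (allFin ℓ))
Consecutive-levels f f-suc zero = []
Consecutive-levels {ℓ} f f-suc (suc H) = Consecutive-++
  (subst (λ y → Consecutive y level) (ℤ.+-identityʳ _) (Consecutive-tabulate (f 0) id 0 (λ _ → refl)))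
  (subst (λ y → Consecutive y (cartesianProduct (applyUpTo (f ∘ suc) H) (allFin ℓ))) start
    (Consecutive-levels (f ∘ suc) (f-suc ∘ suc) H))
  where
  level : List (ℤ × Fin ℓ)
  level = map (f 0 ,_) (allFin ℓ)
  start : f 1 ℤ.* + ℓ ≡ f 0 ℤ.* + ℓ ℤ.+ + length level
  start = begin
    f 1 ℤ.* + ℓ                        ≡⟨ cong (ℤ._* + ℓ) (f-suc 0) ⟩
    ℤ.suc (f 0) ℤ.* + ℓ                ≡⟨ ℤ.suc-* (f 0) (+ ℓ) ⟩
    + ℓ ℤ.+ f 0 ℤ.* + ℓ                ≡⟨ ℤ.+-comm (+ ℓ) (f 0 ℤ.* + ℓ) ⟩
    f 0 ℤ.* + ℓ ℤ.+ + ℓ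
      ≡⟨ cong (λ n → f 0 ℤ.* + ℓ ℤ.+ + n) (sym (trans (length-map (f 0 ,_) (allFin ℓ)) (length-tabulate {n = ℓ} id))) ⟩
    f 0 ℤ.* + ℓ ℤ.+ + length level     ∎
    where open ≡-Reasoning

length-levels : ∀ {ℓ} (f : ℕ → ℤ) H → length (cartesianProduct (applyUpTo f H) (allFin ℓ)) ≡ H * ℓ
length-levels f zero = refl
length-levels {ℓ} f (suc H) = trans (length-++ (map (f 0 ,_) (allFin ℓ)))
  (cong₂ _+_ (trans (length-map (f 0 ,_) (allFin ℓ)) (length-tabulate {n = ℓ} id)) (length-levels (f ∘ suc) H))

-- The window starts at the entry -(len μ * (1 + n)) with no gap before it, which fixes the number
-- of beads to come. All but `len μ` of them belong to empty rows.
window-walk : ∀ μ n → Walk μ (len μ * suc n) 0 (window (abacusOf {n} μ))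
window-walk μ n = walk μ
  (Consecutive-levels (λ h → - + len μ ℤ.+ + h) (λ h → f-suc (- + len μ) (+ 1) (+ h)) (len μ + first μ))
  start
  (≤-reflexive (nth-[] (parts μ) (m≤m*n (len μ) (suc n)))) (λ _ → z≤n)
  (subst (first μ + len μ * suc n ≤_) (sym (trans (length-levels (λ h → - + len μ ℤ.+ + h) (len μ + first μ))
    (*-distribʳ-+ (suc n) (len μ) (first μ))))
    (≤-trans (≤-reflexive (+-comm (first μ) _)) (+-monoʳ-≤ (len μ * suc n) (m≤m*n (first μ) (suc n)))))
  where
  f-suc : ∀ x y z → x ℤ.+ (y ℤ.+ z) ≡ y ℤ.+ (x ℤ.+ z)
  f-suc = ℤSolver.solve-∀
  cancel : ∀ m l → (- m ℤ.+ + 0) ℤ.* l ℤ.+ m ℤ.* l ≡ + 0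
  cancel = ℤSolver.solve-∀
  start : (- + len μ ℤ.+ + 0) ℤ.* + suc n ℤ.+ + (len μ * suc n) ≡ + 0
  start = trans (cong (λ x → (- + len μ ℤ.+ + 0) ℤ.* + suc n ℤ.+ x) (ℤ.pos-* (len μ) (suc n)))
    (cancel (+ len μ) (+ suc n))

-- For nonempty μ the walk starts with beads still to come, so the default runner `fromℕ n` is
-- overwritten.
largestBeadRunner-last : ∀ μ n → 0 < len μ → IsLastBeadRunner μ (largestBeadRunner (abacusOf {n} μ))
largestBeadRunner-last μ n 0<len = foldl-lastBeadRunner μ _ (λ _ _ _ → refl) (window-walk μ n) (fromℕ n)
  λ len*≡0 → contradiction len*≡0 (m<n⇒n≢0 (<-≤-trans 0<len (m≤m*n (len μ) (suc n))))

-- Deleting a runner from the window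

filter-tabulate-punchIn : ∀ {A : Set} {P : A → Set} (P? : Decidable P) {n} (f : Fin (suc n) → A) p →
                          ¬ P (f p) → (∀ {j} → j ≢ p → P (f j)) →
                          filter P? (tabulate f) ≡ tabulate (f ∘ punchIn p)
filter-tabulate-punchIn P? f Fin.zero ¬Pfp Pf = trans (filter-reject P? ¬Pfp)
  (filter-all P? (All.tabulate⁺ (λ j → Pf λ ())))
filter-tabulate-punchIn P? {suc n} f (Fin.suc p) ¬Pfp Pf = trans (filter-accept P? (Pf λ ()))
  (cong (f Fin.zero ∷_) (filter-tabulate-punchIn P? (f ∘ Fin.suc) p ¬Pfp (λ j≢p → Pf (j≢p ∘ Fin.suc-injective))))

-- Turns the word of the smaller abacus into a subword of the original one, to which the walk of μ
-- applies.
map-deleteRunner : ∀ {B : Set} {n} (g : ℤ × Fin (suc n) → B) p rs →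
                   map (λ e → g (proj₁ e , punchIn p (proj₂ e))) (cartesianProduct rs (allFin n)) ≡
                   map g (filter (otherRunner? p) (cartesianProduct rs (allFin (suc n))))
map-deleteRunner g p [] = refl
map-deleteRunner {n = n} g p (r ∷ rs) = begin
  map g′ (map (r ,_) (allFin n) ++ cartesianProduct rs (allFin n))
    ≡⟨ map-++ g′ (map (r ,_) (allFin n)) _ ⟩
  map g′ (map (r ,_) (allFin n)) ++ map g′ (cartesianProduct rs (allFin n))
    ≡⟨ cong₂ _++_ level (map-deleteRunner g p rs) ⟩
  map g (filter (otherRunner? p) (map (r ,_) (allFin (suc n)))) ++
  map g (filter (otherRunner? p) (cartesianProduct rs (allFin (suc n))))
    ≡⟨ sym (map-++ g (filter (otherRunner? p) (map (r ,_) (allFin (suc n)))) _) ⟩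
  map g (filter (otherRunner? p) (map (r ,_) (allFin (suc n))) ++
         filter (otherRunner? p) (cartesianProduct rs (allFin (suc n))))
    ≡⟨ cong (map g) (sym (filter-++ (otherRunner? p) (map (r ,_) (allFin (suc n))) _)) ⟩
  map g (filter (otherRunner? p) (map (r ,_) (allFin (suc n)) ++ cartesianProduct rs (allFin (suc n)))) ∎
  where
  open ≡-Reasoning
  g′ = λ e → g (proj₁ e , punchIn p (proj₂ e))
  level : map g′ (map (r ,_) (allFin n)) ≡ map g (filter (otherRunner? p) (map (r ,_) (allFin (suc n))))
  level = begin
    map g′ (map (r ,_) (allFin n))                                   ≡⟨ cong (map g′) (map-tabulate id (r ,_)) ⟩
    map g′ (tabulate (r ,_))                                         ≡⟨ map-tabulate (r ,_) g′ ⟩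
    tabulate (λ j → g (r , punchIn p j))                             ≡⟨ sym (map-tabulate (λ j → r , punchIn p j) g) ⟩
    map g (tabulate (λ j → r , punchIn p j))
      ≡⟨ cong (map g) (sym (filter-tabulate-punchIn (otherRunner? p) (r ,_) p (λ k → k refl) id)) ⟩
    map g (filter (otherRunner? p) (tabulate (r ,_)))
      ≡⟨ cong (map g ∘ filter (otherRunner? p)) (sym (map-tabulate id (r ,_))) ⟩
    map g (filter (otherRunner? p) (map (r ,_) (allFin (suc n))))    ∎

filter-nonzero : ∀ i xs → filter (i <?_) (nonzero xs) ≡ filter (i <?_) xs
filter-nonzero i [] = refl
filter-nonzero i (zero ∷ xs) = filter-nonzero i xs
filter-nonzero i (suc x ∷ xs) with i <? suc x
... | yes p = trans (filter-accept (i <?_) p) (trans (cong (suc x ∷_) (filter-nonzero i xs)) (sym (filter-accept (i <?_) p)))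
... | no ¬p = trans (filter-reject (i <?_) ¬p) (trans (filter-nonzero i xs) (sym (filter-reject (i <?_) ¬p)))

-- The walk counts over all rows in the window, including empty ones; `count-truncate` cuts this
-- down to the rows meeting column j. The empty partition is treated apart, since its window is
-- empty.
column-Φ : ∀ ℓ .{{_ : NonTrivial ℓ}} μ → IsCore ℓ μ → ∀ j → column (Φ ℓ μ) j ≡ count (kept? ℓ μ) (column μ j)
column-Φ (suc (suc n)) μ core j with 0 <? len μ
... | yes 0<len = begin
  length (filter (j <?_) (nonzero (gapCounts 0 [] w)))      ≡⟨ cong length (filter-nonzero j (gapCounts 0 [] w)) ⟩
  length (filter (j <?_) (gapCounts 0 [] w))
    ≡⟨ cong (length ∘ filter (j <?_) ∘ gapCounts 0 [])
         (map-deleteRunner (λ e → isBead μ (uncurry entry e)) p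
           (applyUpTo (λ h → - + len μ ℤ.+ + h) (len μ + first μ))) ⟩
  length (filter (j <?_) (gapCounts 0 [] (word μ core p p-last j (window A))))
    ≡⟨ count-parts μ core p p-last j (window-walk μ (suc n)) 0 [] (λ _ → refl) ⟩
  count KJ? (len μ * suc (suc n)) + 0                       ≡⟨ +-identityʳ _ ⟩
  count KJ? (len μ * suc (suc n))
    ≡⟨ count-truncate K? (λ m → j <? part μ m) (≤-trans (length-filter (j <?_) (parts μ)) (m≤m*n (len μ) (suc (suc n))))
         (λ _ → column⇒part μ) (λ _ → part⇒column μ) ⟩
  count K? (column μ j)                                     ∎
  where
  open ≡-Reasoning
  A : Abacus (suc (suc n))
  A = abacusOf μ
  p = largestBeadRunner A
  p-last = largestBeadRunner-last μ (suc n) 0<len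
  w = map (uncurry (bead (deleteRunner p A))) (window (deleteRunner p A))
  K? = kept? (suc (suc n)) μ
  KJ? = λ m → K? m ×-dec j <? part μ m
column-Φ (suc (suc n)) (mkPartition [] _ _)       core j | no _ = refl
column-Φ (suc (suc n)) (mkPartition (x ∷ xs) _ _) core j | no 0≮ = contradiction z<s 0≮

-- Numbers of short hooks in the rows

nonzero-applyUpTo : ∀ (f : ℕ → ℕ) m n → (∀ {i} → m ≤ i → f i ≡ 0) → (∀ {i} → n ≤ i → f i ≡ 0) →
                    nonzero (applyUpTo f m) ≡ nonzero (applyUpTo f n)
nonzero-applyUpTo f zero    zero    _  _  = refl
nonzero-applyUpTo f zero    (suc n) m≤ n≤ rewrite m≤ {0} z≤n = nonzero-applyUpTo (f ∘ suc) 0 n (λ _ → m≤ z≤n) (n≤ ∘ s≤s)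
nonzero-applyUpTo f (suc m) zero    m≤ n≤ rewrite n≤ {0} z≤n = nonzero-applyUpTo (f ∘ suc) m 0 (m≤ ∘ s≤s) (λ _ → n≤ z≤n)
nonzero-applyUpTo f (suc m) (suc n) m≤ n≤ with f 0
... | zero  = nonzero-applyUpTo (f ∘ suc) m n (m≤ ∘ s≤s) (n≤ ∘ s≤s)
... | suc x = cong (suc x ∷_) (nonzero-applyUpTo (f ∘ suc) m n (m≤ ∘ s≤s) (n≤ ∘ s≤s))

-- A hook is longer than its arm, so short hooks occur only among the last ℓ boxes of the row.
shortHooks≤ : ∀ ℓ μ i → shortHooks (suc ℓ) μ i ≤ ℓ
shortHooks≤ ℓ μ i = ≤-trans
  (count-lower-bound (λ j → hook μ i j <? suc ℓ) n (n ∸ ℓ) (λ {j} j<n h≤ → m≤n+o⇒m∸n≤o n ℓ (bound j<n h≤)))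
  (m≤n+o⇒m∸n≤o n (n ∸ ℓ) (≤-trans (m≤n+m∸n n ℓ) (≤-reflexive (+-comm ℓ (n ∸ ℓ)))))
  where
  n = part μ i
  bound : ∀ {j} → j < n → hook μ i j < suc ℓ → n ≤ ℓ + j
  bound {j} j<n h≤ = begin
    n                     ≡⟨ sym (m∸n+n≡m j<n) ⟩
    n ∸ suc j + suc j     ≡⟨ +-suc (n ∸ suc j) j ⟩
    suc (n ∸ suc j) + j   ≤⟨ +-monoˡ-≤ j (≤-trans (s≤s (m≤m+n (n ∸ suc j) _)) (s≤s⁻¹ h≤)) ⟩
    ℓ + j                 ∎
    where open ≤-Reasoning

-- Aligning the rows i and 1 + i on the right lowers hook lengths by at most 1, and no hook of a core has length ℓ.
shortHooks-antitone : ∀ {ℓ} μ → IsCore ℓ μ → ∀ i → shortHooks ℓ μ (suc i) ≤ shortHooks ℓ μ i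
shortHooks-antitone {ℓ} μ core i = begin
  count S′? n′                ≤⟨ count-mono S′? (S? ∘ (_+_ d)) n′ shift ⟩
  count (S? ∘ (_+_ d)) n′      ≤⟨ count-shift S? d n′ ⟩
  count S? (d + n′)           ≡⟨ cong (count S?) d+n′ ⟩
  count S? n                  ∎
  where
  open ≤-Reasoning
  n  = part μ i
  n′ = part μ (suc i)
  d  = n ∸ n′
  d+n′ : d + n′ ≡ n
  d+n′ = m∸n+n≡m (part-antitone μ (n≤1+n i))
  S? = λ j → hook μ i j <? ℓ
  S′? = λ j → hook μ (suc i) j <? ℓ
  e : ∀ x i d j → x + (suc i + (d + j)) ≡ d + (x + (suc i + j))
  e = solve-∀
  shift : ∀ {j} → j < n′ → hook μ (suc i) j < ℓ → hook μ i (d + j) < ℓ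
  shift {j} j<n′ h′<ℓ = ≰⇒> λ ℓ≤h → <⇒≱ h′<ℓ
    (s≤s⁻¹ (≤-trans (≤∧≢⇒< ℓ≤h (λ ℓ≡h → core i (d + j) d+j<n (subst (ℓ ∣_) ℓ≡h ∣-refl))) h≤))
    where
    d+j<n : d + j < n
    d+j<n = subst (d + j <_) d+n′ (+-monoʳ-< d j<n′)
    h≤ : hook μ i (d + j) ≤ suc (hook μ (suc i) j)
    h≤ = +-cancelʳ-≤ (d + (suc i + j)) _ _ (begin
      hook μ i (d + j) + (d + (suc i + j))                 ≡⟨ cong (_+_ (hook μ i (d + j))) (e 0 i d j) ⟨
      hook μ i (d + j) + (suc i + (d + j))                 ≡⟨ hook-sum μ d+j<n ⟩
      n + column μ (d + j)                                 ≤⟨ +-monoʳ-≤ n (column-mono μ (m≤n+m j d)) ⟩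
      n + column μ j                                       ≡⟨ cong (_+ column μ j) (sym d+n′) ⟩
      d + n′ + column μ j                                  ≡⟨ +-assoc d n′ (column μ j) ⟩
      d + (n′ + column μ j)                                ≡⟨ cong (_+_ d) (sym (hook-sum μ j<n′)) ⟩
      d + (hook μ (suc i) j + (suc (suc i) + j))           ≡⟨ f d (hook μ (suc i) j) i j ⟩
      suc (hook μ (suc i) j) + (d + (suc i + j))           ∎)
      where
      f : ∀ d x i j → d + (x + (suc (suc i) + j)) ≡ suc x + (d + (suc i + j))
      f = solve-∀

shortHooks-tr : ∀ ℓ μ i → shortHooks ℓ (tr μ) i ≡ shortHooksInColumn ℓ μ i
shortHooks-tr ℓ μ i = trans (cong (count (λ j → hook (tr μ) i j <? ℓ)) (part-tr μ i))
  (count-cong (λ j → hook (tr μ) i j <? ℓ) (λ j → hook μ j i <? ℓ) (column μ i)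
    (λ {j} _ → subst (_< ℓ) (hook-tr μ i j)) (λ {j} _ → subst (_< ℓ) (sym (hook-tr μ i j))))

shortHooksInColumn-tr : ∀ ℓ μ i → shortHooksInColumn ℓ (tr μ) i ≡ shortHooks ℓ μ i
shortHooksInColumn-tr ℓ μ i = trans (cong (count (λ j → hook (tr μ) j i <? ℓ)) (column-tr μ i))
  (count-cong (λ j → hook (tr μ) j i <? ℓ) (λ j → hook μ i j <? ℓ) (part μ i)
    (λ {j} _ → subst (_< ℓ) (hook-tr μ j i)) (λ {j} _ → subst (_< ℓ) (sym (hook-tr μ j i))))

shortHooks-Φ̃ : ∀ ℓ .{{_ : NonTrivial ℓ}} μ → IsCore ℓ μ → ∀ i → i < len μ →
               suc (shortHooks (ℓ ∸ 1) (Φ̃ ℓ μ) i) ≡ shortHooks ℓ μ i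
shortHooks-Φ̃ (suc (suc n)) μ core i i< = begin
  suc (shortHooks (suc n) (Φ̃ ℓ μ) i)              ≡⟨ cong suc (shortHooks-tr (suc n) (Φ ℓ (tr μ)) i) ⟩
  suc (shortHooksInColumn (suc n) (Φ ℓ (tr μ)) i)
    ≡⟨ shortHooksInColumn-deleted (tr μ) core′ (Φ ℓ (tr μ)) (column-Φ ℓ (tr μ) core′) i
         (subst (i <_) (sym (trans (part-tr μ 0) (column-zero μ))) i<) ⟩
  shortHooksInColumn ℓ (tr μ) i                         ≡⟨ shortHooksInColumn-tr ℓ μ i ⟩
  shortHooks ℓ μ i                                 ∎
  where
  open ≡-Reasoning
  ℓ = suc (suc n)
  core′ = IsCore-tr μ core

-- The bijection Υ

parts-injective : ∀ {μ ν} → parts μ ≡ parts ν → μ ≡ ν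
parts-injective {mkPartition xs d p} {mkPartition _ d′ p′} refl =
  cong₂ (mkPartition xs) (Linked.irrelevant ≤-irrelevant d d′) (All.irrelevant ≤-irrelevant p p′)

applyUpTo-cong : ∀ {f g : ℕ → ℕ} n → (∀ {i} → i < n → f i ≡ g i) → applyUpTo f n ≡ applyUpTo g n
applyUpTo-cong zero    f≡g = refl
applyUpTo-cong (suc n) f≡g = cong₂ _∷_ (f≡g z<s) (applyUpTo-cong n (f≡g ∘ s<s))

applyUpTo-nth : ∀ xs → applyUpTo (nth xs) (length xs) ≡ xs
applyUpTo-nth []       = refl
applyUpTo-nth (x ∷ xs) = cong (x ∷_) (applyUpTo-nth xs)

nth-positive : ∀ {xs i} → All (1 ≤_) xs → i < length xs → 1 ≤ nth xs i
nth-positive {i = zero}  (p ∷ _)  _        = p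
nth-positive {i = suc i} (_ ∷ ps) (s≤s i<) = nth-positive ps i<

nth₀-applyUpTo-≤ : ∀ (f : ℕ → ℕ) {b} n → f 0 ≤ b → nth (applyUpTo f n) 0 ≤ b
nth₀-applyUpTo-≤ f zero    _ = z≤n
nth₀-applyUpTo-≤ f (suc n) p = p

-- The zeros of a decreasing list come last, so dropping them moves no other entry.
nth-nonzero : ∀ {xs} → Linked _≥_ xs → ∀ i → nth (nonzero xs) i ≡ nth xs i
nth-nonzero {xs} d i = below-unique
  (λ {j} j< → filter⇒nth d (subst (λ ys → i < length ys) (filter-nonzero j xs) (nth⇒filter d′ j<)))
  (λ {j} j< → filter⇒nth d′ (subst (λ ys → i < length ys) (sym (filter-nonzero j xs)) (nth⇒filter d j<)))
  where d′ = Linked.filter⁺ (1 ≤?_) ≥-trans d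

nth-map-pred-all : ∀ xs i → nth (map pred xs) i ≡ pred (nth xs i)
nth-map-pred-all []       i       = refl
nth-map-pred-all (x ∷ xs) zero    = refl
nth-map-pred-all (x ∷ xs) (suc i) = nth-map-pred-all xs i

part-deleteFirstColumn : ∀ ν i → part (deleteFirstColumn ν) i ≡ pred (part ν i)
part-deleteFirstColumn ν i = trans
  (nth-nonzero (Linked.map⁺ (Linked.map pred-mono-≤ (decreasing ν))) i) (nth-map-pred-all (parts ν) i)

-- All that the deletion forgets is the number of rows of length 1, and the common length restores
-- it.
deleteFirstColumn-injective : ∀ {μ ν} → len μ ≡ len ν → deleteFirstColumn μ ≡ deleteFirstColumn ν → μ ≡ ν
deleteFirstColumn-injective {μ} {ν} len≡ eq = parts-injective (begin
  parts μ                       ≡⟨ sym (applyUpTo-nth (parts μ)) ⟩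
  applyUpTo (part μ) (len μ)    ≡⟨ applyUpTo-cong (len μ) part≡ ⟩
  applyUpTo (part ν) (len μ)    ≡⟨ cong (applyUpTo (part ν)) len≡ ⟩
  applyUpTo (part ν) (len ν)    ≡⟨ applyUpTo-nth (parts ν) ⟩
  parts ν                       ∎)
  where
  open ≡-Reasoning
  part≡ : ∀ {i} → i < len μ → part μ i ≡ part ν i
  part≡ {i} i< = begin
    part μ i                                  ≡⟨ sym (suc-pred _ {{>-nonZero (nth-positive (positive μ) i<)}}) ⟩
    suc (pred (part μ i))                     ≡⟨ cong suc (sym (part-deleteFirstColumn μ i)) ⟩
    suc (part (deleteFirstColumn μ) i)        ≡⟨ cong (λ κ → suc (part κ i)) eq ⟩
    suc (part (deleteFirstColumn ν) i)        ≡⟨ cong suc (part-deleteFirstColumn ν i) ⟩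
    suc (pred (part ν i))                     ≡⟨ suc-pred _ {{>-nonZero (nth-positive (positive ν) (subst (i <_) len≡ i<))}} ⟩
    part ν i                                  ∎

-- `part σ` is 0 beyond `len σ`, so the rows missing up to k become rows of one box.
addFirstColumn : ℕ → Partition → Partition
addFirstColumn k σ = mkPartition (applyUpTo (suc ∘ part σ) k)
  (Linked.applyUpTo⁺₂ _ k (λ i → s≤s (part-antitone σ (n≤1+n i)))) (All.applyUpTo⁺₂ _ k (λ _ → s≤s z≤n))

deleteFirstColumn-addFirstColumn : ∀ {k} σ → len σ ≤ k → deleteFirstColumn (addFirstColumn k σ) ≡ σ
deleteFirstColumn-addFirstColumn {k} σ len≤ = parts-injective (begin
  nonzero (map pred (applyUpTo (suc ∘ part σ) k))   ≡⟨ cong nonzero (map-applyUpTo (suc ∘ part σ) pred k) ⟩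
  nonzero (applyUpTo (part σ) k)
    ≡⟨ nonzero-applyUpTo (part σ) k (len σ) (nth-[] (parts σ) ∘ ≤-trans len≤) (nth-[] (parts σ)) ⟩
  nonzero (applyUpTo (part σ) (len σ))              ≡⟨ cong nonzero (applyUpTo-nth (parts σ)) ⟩
  nonzero (parts σ)                                 ≡⟨ filter-all (1 ≤?_) (positive σ) ⟩
  parts σ                                           ∎)
  where open ≡-Reasoning

PartitionsOfLen-≡ : ∀ {m k} {μ ν : PartitionsOfLen m k} → proj₁ μ ≡ proj₁ ν → μ ≡ ν
PartitionsOfLen-≡ {μ = μ , p , q} {ν = _ , p′ , q′} refl =
  cong₂ (λ x y → μ , x , y) (≤-irrelevant p p′) (≡-irrelevant q q′)

PartitionsOfLen≤-≡ : ∀ {m k} {μ ν : PartitionsOfLen≤ m k} → proj₁ μ ≡ proj₁ ν → μ ≡ ν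
PartitionsOfLen≤-≡ {μ = μ , p , q} {ν = _ , p′ , q′} refl =
  cong₂ (λ x y → μ , x , y) (≤-irrelevant p p′) (≤-irrelevant q q′)

Υ-bijective : ∀ ℓ .{{_ : NonTrivial ℓ}} k → Bijective _≡_ _≡_ (Υ ℓ k)
Υ-bijective (suc (suc n)) k = injective , surjective
  where
  injective : Injective _≡_ _≡_ (Υ (suc (suc n)) k)
  injective {_ , _ , lenμ} {_ , _ , lenν} eq =
    PartitionsOfLen-≡ (deleteFirstColumn-injective (trans lenμ (sym lenν)) (cong proj₁ eq))
  surjective : Surjective _≡_ _≡_ (Υ (suc (suc n)) k)
  surjective (σ , σ₁≤ , lenσ≤) =
    ( addFirstColumn k σ
    , nth₀-applyUpTo-≤ (suc ∘ part σ) k (s≤s σ₁≤)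
    , length-applyUpTo (suc ∘ part σ) k )
    , λ { refl → PartitionsOfLen≤-≡ (deleteFirstColumn-addFirstColumn σ lenσ≤) }

-- Compatibility with the Lapointe-Morse bijections

part-Φ̃-beyond : ∀ ℓ .{{_ : NonTrivial ℓ}} μ → IsCore ℓ μ → ∀ {i} → len μ ≤ i → part (Φ̃ ℓ μ) i ≡ 0
part-Φ̃-beyond ℓ μ core {i} len≤ = begin
  part (Φ̃ ℓ μ) i                                ≡⟨ part-tr (Φ ℓ (tr μ)) i ⟩
  column (Φ ℓ (tr μ)) i                         ≡⟨ column-Φ ℓ (tr μ) (IsCore-tr μ core) i ⟩
  count (kept? ℓ (tr μ)) (column (tr μ) i)      ≡⟨ cong (count (kept? ℓ (tr μ))) (trans (column-tr μ i) (nth-[] (parts μ) len≤)) ⟩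
  0                                             ∎
  where open ≡-Reasoning

theorem4p5p1p3 : (ℓ : ℕ) .{{_ : NonTrivial ℓ}} (k : ℕ) →
    Bijective _≡_ _≡_ (Υ ℓ k)
    × ((μ : Partition) → IsCore ℓ μ → len μ ≡ k →
    Σ[ ν ∈ PartitionsOfLen (ℓ ∸ 1) k ]
    (parts (proj₁ ν) ≡ ρ ℓ μ
    × parts (proj₁ (Υ ℓ k ν)) ≡ ρ (ℓ ∸ 1) (Φ̃ ℓ μ)))
theorem4p5p1p3 ℓ@(suc (suc n)) k = Υ-bijective ℓ k , λ { μ core refl → image μ core }
  where
  image : ∀ μ → IsCore ℓ μ → Σ[ ν ∈ PartitionsOfLen (ℓ ∸ 1) (len μ) ]
          (parts (proj₁ ν) ≡ ρ ℓ μ × parts (proj₁ (Υ ℓ (len μ) ν)) ≡ ρ (ℓ ∸ 1) (Φ̃ ℓ μ))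
  image μ core = (ν , nth₀-applyUpTo-≤ short (len μ) (shortHooks≤ (suc n) μ 0) , length-applyUpTo short (len μ))
               , sym (filter-all (1 ≤?_) positive-ν) , (begin
    nonzero (map pred (applyUpTo short (len μ)))     ≡⟨ cong nonzero (map-applyUpTo short pred (len μ)) ⟩
    nonzero (applyUpTo (pred ∘ short) (len μ))
      ≡⟨ cong nonzero (applyUpTo-cong (len μ) λ i< → cong pred (sym (shortHooks-Φ̃ ℓ μ core _ i<))) ⟩
    nonzero (applyUpTo short′ (len μ))
      -- `Φ̃ ℓ μ` can have fewer rows than μ; both ranges of rows reach past its last nonempty row,
      -- so they differ only in zeros.
      ≡⟨ nonzero-applyUpTo short′ (len μ) (len (Φ̃ ℓ μ))
           (λ {i} len≤ → cong (count (λ j → hook (Φ̃ ℓ μ) i j <? suc n)) (part-Φ̃-beyond ℓ μ core len≤))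
           (λ {i} len≤ → cong (count (λ j → hook (Φ̃ ℓ μ) i j <? suc n)) (nth-[] (parts (Φ̃ ℓ μ)) len≤)) ⟩
    nonzero (applyUpTo short′ (len (Φ̃ ℓ μ)))         ∎)
    where
    open ≡-Reasoning
    short short′ : ℕ → ℕ
    short  = shortHooks ℓ μ
    short′ = shortHooks (suc n) (Φ̃ ℓ μ)
    positive-ν : All (1 ≤_) (applyUpTo short (len μ))
    -- Each row loses exactly one short hook, so it has at least one; hence `ρ ℓ μ` discards no
    -- entry and has exactly `len μ` parts.
    positive-ν = All.applyUpTo⁺₁ short (len μ) λ {i} i< → subst (1 ≤_) (shortHooks-Φ̃ ℓ μ core i i<) (s≤s z≤n)
    ν : Partition
    ν = mkPartition (applyUpTo short (len μ)) (Linked.applyUpTo⁺₂ short (len μ) (shortHooks-antitone μ core)) positive-ν
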